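{- Let $\mathbf{WQSym}$ denote the $\mathbb{K}$-span of the $\mathbf{M}_u$, $u$ running over packed words of length $\ge1$, equipped with the product $\#$ (an associative algebra with unit $\mathbf{M}_1$). Then $(\mathbf{WQSym},\#)$ is a free associative unital algebra, freely generated by $\{\mathbf{S}^u: u\text{ non-secable}\}$, and also freely generated by $\{\mathbf{M}_u: u\text{ non-secable}\}$.
   Context: Let $A=\{a_1<a_2<\cdots\}$ be an infinite totally ordered alphabet (identified with $\{1<2<\cdots\}$) and $\mathbb{K}$ a field; work with formal $\mathbb{K}$-linear combinations of nonempty words over $A$. The $\#$ product of words is $(ux)\#(yv)=uxv$ if the letters $x,y$ are equal and $0$ otherwise ($u,v$ words, $x,y$ letters), extended bilinearly. For a word $w$ with distinct letters $b_1<\dots<b_r$, $\mathrm{pack}(w)$ is the image of $w$ under $b_i\mapsto i$; $w$ is packed if $\mathrm{pack}(w)=w$; $\mathbf{M}_u=\sum_{\mathrm{pack}(w)=u}w$. For a packed word $w$ and $i<j$, the pair $(i,j)$ has coefficient $1$ if $w_i>w_j$, $1/2$ if $w_i=w_j$, $0$ otherwise; $u\le v$ (pseudo-permutohedron order, same length) iff every pair's coefficient in $u$ is at most its coefficient in $v$; $\mathbf{S}^u=\sum_{v\le u}\mathbf{M}_v$. A packed word $u$ of length $n$ is secable if there exists $k$ with $2\le k<n$ such that (i) the set $\{u_1,\dots,u_k\}$ is the union of an interval of integers with maximal element $u_k$ and another interval of integers which is either empty or has maximal element $\max(u)$, and (ii) $\{u_1,\dots,u_k\}\cap\{u_k,\dots,u_n\}=\{u_k\}$.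 A packed word is non-secable if it has length at least $2$ and is not secable. -}

module Defs where

open import Level using (Level; _⊔_)
open import Algebra.Bundles using (CommutativeRing)
open import Data.Nat as ℕ using (ℕ; zero; suc; _≤_; _<_; _<ᵇ_; _≡ᵇ_)
open import Data.Nat.Properties using (_≟_)
open import Data.Bool using (Bool; true; false; if_then_else_; _∧_; T?)
open import Data.List using (List; []; _∷_; length; map; filter; foldr; take; drop; upTo; deduplicate; concatMap)
open import Data.List.Membership.Propositional using (_∈_)
open import Data.List.Relation.Unary.All using (All)
open import Data.List.Relation.Unary.Unique.Propositional using (Unique)
open import Data.Product using (Σ; ∃; _×_; _,_; proj₁; proj₂)
open import Data.Sum using (_⊎_)
open import Data.Empty using (⊥)
open import Relation.Nullary using (¬_; does)
open import Relation.Binary.PropositionalEquality using (_≡_)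
open import Data.List.Properties using (≡-dec)
open import Function.Bundles using (_⇔_)

record Field (c ℓ : Level) : Set (Level.suc (c ⊔ ℓ)) where
  field
    commutativeRing : CommutativeRing c ℓ
  open CommutativeRing commutativeRing public
  field
    1≉0     : ¬ (1# ≈ 0#)
    inverse : ∀ x → ¬ (x ≈ 0#) → ∃ λ y → (x * y) ≈ 1#

-- Words. The alphabet is ℕ with its usual order (order-isomorphic to
-- {1 < 2 < ...}). A word is a list of letters.

Word : Set
Word = List ℕ

-- i-th letter (0-indexed), default 0 outside the word
at : Word → ℕ → ℕ
at []       _       = 0
at (x ∷ _)  zero    = x
at (_ ∷ w)  (suc i) = at w i

maxW : Word → ℕ
maxW = foldr ℕ._⊔_ 0

pack : Word → Word
pack w = map (λ x → suc (length (deduplicate _≟_ (filter (λ y → y ℕ.<? x) w)))) w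

IsPacked : Word → Set
IsPacked u = pack u ≡ u

allWords : ℕ → ℕ → List Word
allWords zero    m = [] ∷ []
allWords (suc n) m = concatMap (λ x → map (x ∷_) (allWords n m)) (map suc (upTo m))

packedWords : ℕ → List Word
packedWords n = filter (λ w → ≡-dec _≟_ (pack w) w) (allWords n n)

-- Pseudo-permutohedron order. Coefficients doubled: 2 for w_i > w_j,
-- 1 for w_i = w_j, 0 otherwise.

coef2 : Word → ℕ → ℕ → ℕ
coef2 w i j = if at w j <ᵇ at w i then 2 else (if at w i ≡ᵇ at w j then 1 else 0)

allB : {A : Set} → (A → Bool) → List A → Bool
allB p = foldr (λ x b → p x ∧ b) true

_≤PPᵇ_ : Word → Word → Bool
u ≤PPᵇ v = (length u ≡ᵇ length v) ∧
  allB (λ j → allB (λ i → coef2 u i j ℕ.≤ᵇ coef2 v i j) (upTo j)) (upTo (length u))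

-- Secable / non-secable packed words (positions 1-indexed in the paper;
-- u_k = at u (k-1), {u_1..u_k} = take k u, {u_k..u_n} = drop (k-1) u).

InInterval : ℕ → ℕ → ℕ → Set
InInterval a b x = (a ≤ x) × (x ≤ b)

SecableAt : Word → ℕ → Set
SecableAt u k =
  (2 ≤ k) × (k < length u) ×
  (Σ ℕ λ a → (a ≤ at u (k ℕ.∸ 1)) ×
     ( (∀ x → (x ∈ take k u) ⇔ InInterval a (at u (k ℕ.∸ 1)) x)
     ⊎ (Σ ℕ λ c → (c ≤ maxW u) ×
          (∀ x → (x ∈ take k u) ⇔ (InInterval a (at u (k ℕ.∸ 1)) x ⊎ InInterval c (maxW u) x))))) ×
  (∀ x → x ∈ take k u → x ∈ drop (k ℕ.∸ 1) u → x ≡ at u (k ℕ.∸ 1))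

Secable : Word → Set
Secable u = ∃ λ k → SecableAt u k

NonSecable : Word → Set
NonSecable u = IsPacked u × (2 ≤ length u) × ¬ Secable u

-- The algebra: formal (possibly infinite) K-linear combinations of words,
-- represented by their coefficient functions, with the # product.

module WQSymDefs {c ℓ : Level} (K : Field c ℓ) where
  open Field K

  Series : Set c
  Series = Word → Carrier

  zeroS : Series
  zeroS _ = 0#

  _+S_ : Series → Series → Series
  (f +S g) w = f w + g w

  _·S_ : Carrier → Series → Series
  (a ·S f) w = a * f w

  _≈S_ : Series → Series → Set ℓ
  f ≈S g = ∀ w → f w ≈ g w

  sumK : List Carrier → Carrier
  sumK = foldr _+_ 0#

  -- (f # g)(w) = Σ_{k=1}^{|w|} f(w_1..w_k) · g(w_k..w_n):
  -- the word product (ux)#(yv) = [x = y] uxv, extended (bi)linearly.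
  _#_ : Series → Series → Series
  (f # g) w = sumK (map (λ k → f (take (suc k) w) * g (drop k w)) (upTo (length w)))

  M : Word → Series
  M u w = if does (≡-dec _≟_ (pack w) u) then 1# else 0#

  sumS : List Series → Series
  sumS = foldr _+S_ zeroS

  S : Word → Series
  S u = sumS (map M (filter (λ v → T? (v ≤PPᵇ u)) (packedWords (length u))))

  -- Free generation of (WQSym, #) by the family {gen u : P u}:
  -- the monomials gen u₁ # ⋯ # gen u_r (r ≥ 0; the empty monomial is the
  -- unit M_1) form a K-basis of WQSym = span{M_u : u packed, |u| ≥ 1}.
  monomial : (Word → Series) → List Word → Series
  monomial gen []       = M (1 ∷ [])
  monomial gen (u ∷ us) = gen u # monomial gen us

  lincomb : {I : Set} → (I → Series) → List (Carrier × I) → Series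
  lincomb b xs = sumS (map (λ p → proj₁ p ·S b (proj₂ p)) xs)

  InWQSym : Series → Set (c ⊔ ℓ)
  InWQSym f = ∃ λ (xs : List (Carrier × Word)) →
    All (λ p → IsPacked (proj₂ p) × (1 ≤ length (proj₂ p))) xs × (f ≈S lincomb M xs)

  FreelyGenerates : (Word → Series) → (Word → Set) → Set (c ⊔ ℓ)
  FreelyGenerates gen P =
    (∀ u → P u → InWQSym (gen u)) ×
    (∀ (xs : List (Carrier × List Word)) →
       All (λ p → All P (proj₂ p)) xs →
       Unique (map proj₂ xs) →
       lincomb (monomial gen) xs ≈S zeroS →
       All (λ p → proj₁ p ≈ 0#) xs) ×
    (∀ f → InWQSym f →
       ∃ λ (xs : List (Carrier × List Word)) →
         All (λ p → All P (proj₂ p)) xs × (f ≈S lincomb (monomial gen) xs))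

{-# OPTIONS --safe #-}
module Submission where

-- Call k a cut of w if, for i ≤ k ≤ j, w_i ≤ w_j forces w_i ≤ w_k ≤ w_j.  A packed word u is secable exactly when it
-- has a cut strictly between its ends, and w has a cut at k exactly when it is the greatest word, for the
-- pseudo-permutohedron order, whose two factors meeting at k have the order types of its own factors.  Cuts of a
-- prefix of w ending in a cut are the cuts of w inside that prefix; so cutting at the first cut again and again
-- is a bijection from packed words to sequences of non-secable words, whose inverse is top.  Both S^u and M_u equal
-- M_u plus lower terms, hence the monomial on u_1, …, u_r is M_{top(u_1, …, u_r)} plus lower terms, and a
-- unitriangular family indexed by all packed words is a basis.

open import Defs
open import Level as Level using (Level)
open import Data.Bool using (true; false; T; T?; if_then_else_)
open import Data.Bool.Properties using (T-∧)
open import Data.Empty using (⊥-elim)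
open import Data.Nat.Properties
open import Data.List using (List; []; _∷_; _++_; length; map; filter; take; drop; upTo; applyUpTo; deduplicate)
open import Data.List.Membership.Propositional using (_∈_; find)
open import Data.List.Membership.Propositional.Properties
open import Data.List.Membership.DecPropositional _≟_ using (_∈?_)
open import Data.List.Properties using (length-map; length-take; length-drop; length-applyUpTo; length-++; length-++-sucʳ; filter-notAll; ≡-dec)
open import Data.List.Relation.Binary.Subset.Propositional using (_⊆_)
open import Data.List.Relation.Binary.Disjoint.Propositional using (Disjoint)
open import Data.List.Relation.Unary.All as All using (All; []; _∷_)
import Data.List.Relation.Unary.All.Properties as All
open import Data.List.Relation.Unary.AllPairs as AllPairs using (AllPairs; []; _∷_)
import Data.List.Relation.Unary.AllPairs.Properties as AllPairs
open import Data.List.Relation.Unary.Any as Any using (here; there)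
open import Data.List.Relation.Unary.Unique.Propositional using (Unique)
import Data.List.Relation.Unary.Unique.Propositional.Properties as Unique
open import Data.List.Relation.Unary.Unique.DecPropositional.Properties _≟_ using (deduplicate-!)
open import Data.Nat using (ℕ; zero; suc; pred; _+_; _∸_; _⊓_; _≤_; _<_; _<ᵇ_; _≡ᵇ_; z≤n; s≤s; z<s; _≤?_; _<?_)
open import Data.Nat.Induction using (<-wellFounded)
open import Data.Nat.ListAction using (sum)
open import Data.Product using (∃; _×_; _,_; proj₁; proj₂; swap)
open import Data.Sum using (_⊎_; inj₁; inj₂)
open import Function using (_∘_; id; _on_)
open import Function.Bundles using (_⇔_; mk⇔; module Equivalence)
open import Induction.WellFounded using (Acc; acc)
open import Relation.Binary using (tri<; tri≈; tri>)
open import Relation.Binary.PropositionalEquality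
open import Relation.Nullary using (¬_; Dec; yes; no; does; contradiction)
open import Relation.Nullary.Decidable using (map′; _→-dec_; _×-dec_; dec-true; dec-false)

-- Positions and letters of words

at-∈ : ∀ w {i} → i < length w → at w i ∈ w
at-∈ (x ∷ w) {zero}  _         = here refl
at-∈ (x ∷ w) {suc i} (s≤s i<n) = there (at-∈ w i<n)

∈-at : ∀ {w x} → x ∈ w → ∃ λ i → i < length w × at w i ≡ x
∈-at (here refl) = 0 , z<s , refl
∈-at (there x∈w) with i , i<n , eq ← ∈-at x∈w = suc i , s≤s i<n , eq

at-map : ∀ f w {i} → i < length w → at (map f w) i ≡ f (at w i)
at-map f (x ∷ w) {zero}  _         = refl
at-map f (x ∷ w) {suc i} (s≤s i<n) = at-map f w i<n

at-take : ∀ k w {i} → i < k → at (take k w) i ≡ at w i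
at-take (suc k) []      _                 = refl
at-take (suc k) (x ∷ w) {zero}  _         = refl
at-take (suc k) (x ∷ w) {suc i} (s≤s i<k) = at-take k w i<k

at-drop : ∀ k w i → at (drop k w) i ≡ at w (k + i)
at-drop zero    w       i = refl
at-drop (suc k) []      i = refl
at-drop (suc k) (x ∷ w) i = at-drop k w i

at-++ˡ : ∀ v w {i} → i < length v → at (v ++ w) i ≡ at v i
at-++ˡ (x ∷ v) w {zero}  _         = refl
at-++ˡ (x ∷ v) w {suc i} (s≤s i<n) = at-++ˡ v w i<n

at-++ʳ : ∀ v w i → at (v ++ w) (length v + i) ≡ at w i
at-++ʳ []      w i = refl
at-++ʳ (x ∷ v) w i = at-++ʳ v w i

at-ext : ∀ {v w} → length v ≡ length w → (∀ {i} → i < length v → at v i ≡ at w i) → v ≡ w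
at-ext {[]}    {[]}    _   _  = refl
at-ext {x ∷ v} {y ∷ w} len eq = cong₂ _∷_ (eq {0} z<s) (at-ext (suc-injective len) (eq ∘ s≤s))

<-take⁺ : ∀ k (w : Word) {i} → i < k → i < length w → i < length (take k w)
<-take⁺ k w i<k i<n = subst (_ <_) (sym (length-take k w)) (⊓-pres-m< i<k i<n)

<-take⁻ : ∀ k (w : Word) {i} → i < length (take k w) → i < k × i < length w
<-take⁻ k w i<n = m<n⊓o⇒m<n k (length w) lt , m<n⊓o⇒m<o k (length w) lt
  where lt = subst (_ <_) (length-take k w) i<n

<-drop⁺ : ∀ k (w : Word) {i} → k + i < length w → i < length (drop k w)
<-drop⁺ zero    w       lt       = lt
<-drop⁺ (suc k) (x ∷ w) (s≤s lt) = <-drop⁺ k w lt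

<-drop⁻ : ∀ k (w : Word) {i} → i < length (drop k w) → k + i < length w
<-drop⁻ zero    w       lt = lt
<-drop⁻ (suc k) (x ∷ w) lt = s≤s (<-drop⁻ k w lt)

length-take-≤ : ∀ k (w : Word) → k ≤ length w → length (take k w) ≡ k
length-take-≤ k w k≤n = trans (length-take k w) (m≤n⇒m⊓n≡m k≤n)

∈-take⁺ : ∀ k (w : Word) {i} → i < k → i < length w → at w i ∈ take k w
∈-take⁺ k w i<k i<n = subst (_∈ take k w) (at-take k w i<k) (at-∈ (take k w) (<-take⁺ k w i<k i<n))

∈-take⁻ : ∀ k (w : Word) {x} → x ∈ take k w → ∃ λ i → i < k × i < length w × at w i ≡ x
∈-take⁻ k w x∈ with i , i< , eq ← ∈-at x∈ with i<k , i<n ← <-take⁻ k w i< =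
  i , i<k , i<n , trans (sym (at-take k w i<k)) eq

∈-drop⁺ : ∀ k (w : Word) {j} → k ≤ j → j < length w → at w j ∈ drop k w
∈-drop⁺ k w k≤j j<n with i , refl ← m≤n⇒∃[o]m+o≡n k≤j =
  subst (_∈ drop k w) (at-drop k w i) (at-∈ (drop k w) (<-drop⁺ k w j<n))

∈-drop⁻ : ∀ k (w : Word) {x} → x ∈ drop k w → ∃ λ j → k ≤ j × j < length w × at w j ≡ x
∈-drop⁻ k w x∈ with i , i< , eq ← ∈-at x∈ =
  k + i , m≤m+n k i , <-drop⁻ k w i< , trans (sym (at-drop k w i)) eq

∈⇒≤maxW : ∀ {w x} → x ∈ w → x ≤ maxW w
∈⇒≤maxW {x ∷ w} (here refl) = m≤m⊔n x (maxW w)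
∈⇒≤maxW {y ∷ w} (there x∈w) = ≤-trans (∈⇒≤maxW x∈w) (m≤n⊔m y (maxW w))

-- Order types of words

-- One half of having the same order type: ties of `v` stay ties in `w`, while strict inequalities
-- may collapse. With both directions, `≃` amounts to equal packing, see `≃⇒pack-≡`.
record _↝_ (v w : Word) : Set where
  field
    len  : length v ≡ length w
    mono : ∀ {i j} → i < length v → j < length v → at v i ≤ at v j → at w i ≤ at w j

open _↝_

_≃_ : Word → Word → Set
v ≃ w = v ↝ w × w ↝ v

↝-refl : ∀ {w} → w ↝ w
↝-refl = record { len = refl ; mono = λ _ _ → id }

↝-trans : ∀ {u v w} → u ↝ v → v ↝ w → u ↝ w
↝-trans p q = record
  { len  = trans (len p) (len q)
  ; mono = λ i<n j<n → mono q (subst (_ <_) (len p) i<n) (subst (_ <_) (len p) j<n) ∘ mono p i<n j<n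
  }

≃-sym : ∀ {v w} → v ≃ w → w ≃ v
≃-sym = swap

≃-trans : ∀ {u v w} → u ≃ v → v ≃ w → u ≃ w
≃-trans (p , p′) (q , q′) = ↝-trans p q , ↝-trans q′ p′

≡⇒≃ : ∀ {v w} → v ≡ w → v ≃ w
≡⇒≃ refl = ↝-refl , ↝-refl

↝-take : ∀ k {v w} → v ↝ w → take k v ↝ take k w
↝-take k {v} {w} p = record
  { len  = trans (length-take k v) (trans (cong (k ⊓_) (len p)) (sym (length-take k w)))
  ; mono = λ i< j< le →
      let i<k , i<n = <-take⁻ k v i<
          j<k , j<n = <-take⁻ k v j<
      in subst₂ _≤_ (sym (at-take k w i<k)) (sym (at-take k w j<k))
           (mono p i<n j<n (subst₂ _≤_ (at-take k v i<k) (at-take k v j<k) le))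
  }

↝-drop : ∀ k {v w} → v ↝ w → drop k v ↝ drop k w
↝-drop k {v} {w} p = record
  { len  = trans (length-drop k v) (trans (cong (_∸ k) (len p)) (sym (length-drop k w)))
  ; mono = λ {i} {j} i< j< le →
      subst₂ _≤_ (sym (at-drop k w i)) (sym (at-drop k w j))
        (mono p (<-drop⁻ k v i<) (<-drop⁻ k v j<) (subst₂ _≤_ (at-drop k v i) (at-drop k v j) le))
  }

≃-take : ∀ k {v w} → v ≃ w → take k v ≃ take k w
≃-take k (p , q) = ↝-take k p , ↝-take k q

≃-drop : ∀ k {v w} → v ≃ w → drop k v ≃ drop k w
≃-drop k (p , q) = ↝-drop k p , ↝-drop k q

↝-strict : ∀ {v w} → w ↝ v → ∀ {i j} → i < length v → j < length v → at v i < at v j → at w i < at w j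
↝-strict q i<n j<n lt =
  ≰⇒> (<⇒≱ lt ∘ mono q (subst (_ <_) (sym (len q)) j<n) (subst (_ <_) (sym (len q)) i<n))

↝-map : ∀ {f : ℕ → ℕ} w → (∀ {x y} → x ∈ w → y ∈ w → x ≤ y → f x ≤ f y) → w ↝ map f w
↝-map {f} w f-mono = record
  { len  = sym (length-map f w)
  ; mono = λ i<n j<n → subst₂ _≤_ (sym (at-map f w i<n)) (sym (at-map f w j<n)) ∘ f-mono (at-∈ w i<n) (at-∈ w j<n)
  }

map-↝ : ∀ {f : ℕ → ℕ} w → (∀ {x y} → x ∈ w → y ∈ w → x < y → f x < f y) → map f w ↝ w
map-↝ {f} w f-mono = record
  { len  = length-map f w
  ; mono = λ i< j< le →
      let i<n = subst (_ <_) (length-map f w) i<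
          j<n = subst (_ <_) (length-map f w) j<
      in ≮⇒≥ (λ lt → ≤⇒≯ le (subst₂ _<_ (sym (at-map f w j<n)) (sym (at-map f w i<n))
                               (f-mono (at-∈ w j<n) (at-∈ w i<n) lt)))
  }

-- Packing

-- Pigeonhole by induction on `xs`: the head is removed from `ys` at one occurrence, and uniqueness
-- keeps the tail inside what is left.
unique-⊆⇒length-≤ : ∀ {A : Set} {xs ys : List A} → Unique xs → xs ⊆ ys → length xs ≤ length ys
unique-⊆⇒length-≤ {xs = []}     _          _     = z≤n
unique-⊆⇒length-≤ {xs = x ∷ xs} (x∉ ∷ xs!) xs⊆ys with ys₁ , ys₂ , refl ← ∈-∃++ (xs⊆ys (here refl)) =
  subst (suc (length xs) ≤_) (sym (length-++-sucʳ ys₁ x ys₂))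
    (s≤s (unique-⊆⇒length-≤ xs! xs⊆ys₁ys₂))
  where
  xs⊆ys₁ys₂ : xs ⊆ ys₁ ++ ys₂
  xs⊆ys₁ys₂ z∈xs with ∈-++⁻ ys₁ (xs⊆ys (there z∈xs))
  ... | inj₁ z∈ys₁         = ∈-++⁺ˡ z∈ys₁
  ... | inj₂ (here refl)   = contradiction refl (All.lookup x∉ z∈xs)
  ... | inj₂ (there z∈ys₂) = ∈-++⁺ʳ ys₁ z∈ys₂

-- Injectivity is asked on members only, because ranks separate the letters of a word but not
-- arbitrary numbers.
unique-map⁺ : ∀ {A B : Set} {f : A → B} {xs} → (∀ {x y} → x ∈ xs → y ∈ xs → f x ≡ f y → x ≡ y) →
  Unique xs → Unique (map f xs)
unique-map⁺ {f = f} inj xs! = AllPairs.map⁺ (go inj xs!)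
  where
  go : ∀ {xs} → (∀ {x y} → x ∈ xs → y ∈ xs → f x ≡ f y → x ≡ y) → Unique xs → AllPairs (_≢_ on f) xs
  go inj []         = []
  go inj (x∉ ∷ xs!) =
    All.tabulate (λ y∈ eq → All.lookup x∉ y∈ (inj (here refl) (there y∈) eq)) ∷
    go (λ x∈ y∈ → inj (there x∈) (there y∈)) xs!

lettersBelow : Word → ℕ → List ℕ
lettersBelow w x = deduplicate _≟_ (filter (λ y → y <? x) w)

∈-lettersBelow⁺ : ∀ {w x y} → y ∈ w → y < x → y ∈ lettersBelow w x
∈-lettersBelow⁺ y∈w y<x = ∈-deduplicate⁺ _≟_ (∈-filter⁺ (_<? _) y∈w y<x)

∈-lettersBelow⁻ : ∀ w x {y} → y ∈ lettersBelow w x → y ∈ w × y < x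
∈-lettersBelow⁻ w x y∈ = ∈-filter⁻ (_<? x) (∈-deduplicate⁻ _≟_ (filter (_<? x) w) y∈)

-- Definitionally the function that `pack w` maps over `w`.
rankIn : Word → ℕ → ℕ
rankIn w x = suc (length (lettersBelow w x))

rankIn-mono-≤ : ∀ w {x y} → x ≤ y → rankIn w x ≤ rankIn w y
rankIn-mono-≤ w {x} {y} x≤y = s≤s (unique-⊆⇒length-≤ (deduplicate-! _) λ z∈ →
  let z∈w , z<x = ∈-lettersBelow⁻ w x z∈ in ∈-lettersBelow⁺ z∈w (≤-trans z<x x≤y))

-- Strict because `x` itself is counted below `y` but not below `x`.
rankIn-mono-< : ∀ {w x y} → x ∈ w → x < y → rankIn w x < rankIn w y
rankIn-mono-< {w} {x} {y} x∈w x<y = s≤s (unique-⊆⇒length-≤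
  (All.tabulate (λ z∈ x≡z → <⇒≢ (proj₂ (∈-lettersBelow⁻ w x z∈)) (sym x≡z)) ∷ deduplicate-! _)
  λ { (here refl) → ∈-lettersBelow⁺ x∈w x<y
    ; (there z∈)  → let z∈w , z<x = ∈-lettersBelow⁻ w x z∈ in ∈-lettersBelow⁺ z∈w (<-trans z<x x<y) })

pack-≃ : ∀ w → pack w ≃ w
pack-≃ w = map-↝ w (λ x∈w _ → rankIn-mono-< x∈w) , ↝-map w (λ _ _ → rankIn-mono-≤ w)

length-pack : ∀ w → length (pack w) ≡ length w
length-pack w = length-map (rankIn w) w

-- `rankIn w` restricts to a bijection from the letters of `w` below `x` to the letters of `pack w`
-- below `rankIn w x`; surjectivity gives `below≤` and injectivity `below≥`.
rankIn-pack : ∀ w x → x ∈ w → rankIn (pack w) (rankIn w x) ≡ rankIn w x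
rankIn-pack w x x∈w = cong suc (≤-antisym below≤ below≥)
  where
  f = rankIn w
  below≤ : length (lettersBelow (pack w) (f x)) ≤ length (lettersBelow w x)
  below≤ = ≤-trans
    (unique-⊆⇒length-≤ {ys = map f (lettersBelow w x)} (deduplicate-! _) λ z∈ →
      let z∈pw , z<fx = ∈-lettersBelow⁻ (pack w) (f x) z∈
          y , y∈w , z≡fy = ∈-map⁻ f z∈pw
      in subst (_∈ map f (lettersBelow w x)) (sym z≡fy) (∈-map⁺ f (∈-lettersBelow⁺ y∈w
           (≰⇒> λ x≤y → <⇒≱ z<fx (subst (f x ≤_) (sym z≡fy) (rankIn-mono-≤ w x≤y))))))
    (≤-reflexive (length-map f (lettersBelow w x)))
  inj : ∀ {y z} → y ∈ w → z ∈ w → f y ≡ f z → y ≡ z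
  inj {y} {z} y∈w z∈w eq with <-cmp y z
  ... | tri< y<z _ _ = contradiction eq (<⇒≢ (rankIn-mono-< y∈w y<z))
  ... | tri≈ _ y≡z _ = y≡z
  ... | tri> _ _ z<y = contradiction (sym eq) (<⇒≢ (rankIn-mono-< z∈w z<y))
  ∈w : ∀ {y} → y ∈ lettersBelow w x → y ∈ w
  ∈w = proj₁ ∘ ∈-lettersBelow⁻ w x
  below≥ : length (lettersBelow w x) ≤ length (lettersBelow (pack w) (f x))
  below≥ = ≤-trans (≤-reflexive (sym (length-map f (lettersBelow w x))))
    (unique-⊆⇒length-≤ (unique-map⁺ (λ y∈ z∈ → inj (∈w y∈) (∈w z∈)) (deduplicate-! _)) λ z∈ →
      let y , y∈ , z≡fy = ∈-map⁻ f z∈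
          y∈w , y<x = ∈-lettersBelow⁻ w x y∈
      in subst (_∈ lettersBelow (pack w) (f x)) (sym z≡fy)
           (∈-lettersBelow⁺ (∈-map⁺ f y∈w) (rankIn-mono-< y∈w y<x)))

pack-packed : ∀ w → IsPacked (pack w)
pack-packed w = at-ext (length-pack (pack w)) λ {i} i< →
  let i<p = subst (i <_) (length-pack (pack w)) i<
      i<n = subst (i <_) (length-pack w) i<p
  in begin
    at (pack (pack w)) i                   ≡⟨ at-map _ (pack w) i<p ⟩
    rankIn (pack w) (at (pack w) i)        ≡⟨ cong (rankIn (pack w)) (at-map _ w i<n) ⟩
    rankIn (pack w) (rankIn w (at w i))    ≡⟨ rankIn-pack w _ (at-∈ w i<n) ⟩
    rankIn w (at w i)                      ≡⟨ at-map _ w i<n ⟨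
    at (pack w) i                          ∎
  where open ≡-Reasoning

packed-rankIn : ∀ {u x} → IsPacked u → x ∈ u → x ≡ rankIn u x
packed-rankIn {u} u-packed x∈u with i , i<n , refl ← ∈-at x∈u =
  trans (cong (λ v → at v i) (sym u-packed)) (at-map _ u i<n)

packed-≥1 : ∀ {u x} → IsPacked u → x ∈ u → 1 ≤ x
packed-≥1 u-packed x∈u = subst (1 ≤_) (sym (packed-rankIn u-packed x∈u)) (s≤s z≤n)

-- A packed word has no gaps. If `y` has `r` smaller letters then `y` is `r + 1`; a missing number
-- below `y`, added to those letters, would give `r + 1` distinct elements of `{1, …, r}`.
packed-downward : ∀ {u x y} → IsPacked u → y ∈ u → 1 ≤ x → x ≤ y → x ∈ u
packed-downward {u} {suc x} {y} u-packed y∈u _ x≤y with suc x ∈? u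
... | yes x∈u = x∈u
... | no  x∉u = contradiction
  (≤-trans
    (unique-⊆⇒length-≤ (All.tabulate (λ z∈ x≡z → x∉u (subst (_∈ u) (sym x≡z) (proj₁ (∈-lettersBelow⁻ u y z∈)))) ∷ deduplicate-! _)
      (λ { (here refl) → range (s≤s z≤n) (≤∧≢⇒< x≤y (λ { refl → x∉u y∈u }))
         ; (there z∈) → let z∈u , z<y = ∈-lettersBelow⁻ u y z∈ in range (packed-≥1 u-packed z∈u) z<y }))
    (≤-reflexive (length-applyUpTo suc (length (lettersBelow u y)))))
  (<⇒≱ ≤-refl)
  where
  range : ∀ {z} → 1 ≤ z → z < y → z ∈ applyUpTo suc (length (lettersBelow u y))
  range {suc z} _ z<y = ∈-applyUpTo⁺ suc (≤-pred (subst (suc z <_) (packed-rankIn u-packed y∈u) z<y))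

-- Induction on the letter: since there are no gaps, the preceding letter occurs in `u` at some `j`,
-- and `v` must also increase strictly from `j` to `i`.
packed-≤ : ∀ {u v} → IsPacked u → IsPacked v → u ≃ v → ∀ x {i} → i < length u → at u i ≡ x → x ≤ at v i
packed-≤ u-packed v-packed _ zero _ _ = z≤n
packed-≤ {u} {v} u-packed v-packed u≃v@(u↝v , v↝u) (suc x) {i} i<n eq with 1 ≤? x
... | no x≱1 rewrite n<1⇒n≡0 (≰⇒> x≱1) = packed-≥1 v-packed (at-∈ v (subst (i <_) (len u↝v) i<n))
... | yes 1≤x =
  let j , j<n , eq′ = ∈-at (packed-downward u-packed (at-∈ u i<n) 1≤x (≤-trans (n≤1+n x) (≤-reflexive (sym eq))))
  in ≤-trans (s≤s (packed-≤ u-packed v-packed u≃v x j<n eq′))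
       (↝-strict v↝u j<n i<n (≤-reflexive (trans (cong suc eq′) (sym eq))))

packed-≃⇒≡ : ∀ {u v} → IsPacked u → IsPacked v → u ≃ v → u ≡ v
packed-≃⇒≡ {u} {v} u-packed v-packed u≃v = at-ext (len (proj₁ u≃v)) λ i<n → ≤-antisym
  (packed-≤ u-packed v-packed u≃v _ i<n refl)
  (packed-≤ v-packed u-packed (≃-sym u≃v) _ (subst (_ <_) (len (proj₁ u≃v)) i<n) refl)

≃⇒pack-≡ : ∀ {v w} → v ≃ w → pack v ≡ pack w
≃⇒pack-≡ {v} {w} v≃w = packed-≃⇒≡ (pack-packed v) (pack-packed w)
  (≃-trans (pack-≃ v) (≃-trans v≃w (≃-sym (pack-≃ w))))

-- Cuts and secability

-- k counts positions from 0, so that it corresponds to SecableAt u (k + 1).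
Cut : Word → ℕ → Set
Cut w k = ∀ i j → i ≤ k → k ≤ j → j < length w → at w i ≤ at w j → at w i ≤ at w k × at w k ≤ at w j

cut? : ∀ w k → Dec (Cut w k)
cut? w k = map′
  (λ f i j i≤k k≤j j<n → f (s≤s i≤k) j<n k≤j)
  (λ c {i} i<sk {j} j<n k≤j → c i j (≤-pred i<sk) k≤j j<n)
  (allUpTo? (λ i → allUpTo? (λ j → k ≤? j →-dec at w i ≤? at w j →-dec (at w i ≤? at w k ×-dec at w k ≤? at w j))
    (length w)) (suc k))

-- The trivial cut at the end guarantees that the search for a first cut in `factorize` succeeds.
cut-last : ∀ w {k} → suc k ≡ length w → Cut w k
cut-last w {k} eq i j i≤k k≤j j<n le with refl ← ≤-antisym k≤j (≤-pred (subst (j <_) (sym eq) j<n)) = le , ≤-refl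

cut-≃ : ∀ {v w k} → v ≃ w → Cut v k → Cut w k
cut-≃ (p , q) c i j i≤k k≤j j<n le =
  let j<m = subst (j <_) (len q) j<n
      k<m = ≤-<-trans k≤j j<m
      i<m = ≤-<-trans i≤k k<m
      l , r = c i j i≤k k≤j j<m (mono q (subst (i <_) (len p) i<m) j<n le)
  in mono p i<m k<m l , mono p k<m j<m r

cut-take : ∀ {w k} m → Cut w k → Cut (take m w) k
cut-take {w} {k} m c i j i≤k k≤j j< le =
  let j<m , j<n = <-take⁻ m w j<
      ek = at-take m w (≤-<-trans k≤j j<m)
      ei = at-take m w (≤-<-trans i≤k (≤-<-trans k≤j j<m))
      ej = at-take m w j<m
      l , r = c i j i≤k k≤j j<n (subst₂ _≤_ ei ej le)
  in subst₂ _≤_ (sym ei) (sym ek) l , subst₂ _≤_ (sym ek) (sym ej) r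

-- If `j` lies beyond `m`, the cut at `m` inserts `w_m` between `w_i` and `w_j`; then `m` takes the
-- place of `j` inside the prefix.
cut-untake : ∀ {w k m} → k ≤ m → m < length w → Cut w m → Cut (take (suc m) w) k → Cut w k
cut-untake {w} {k} {m} k≤m m<n cm ck i j i≤k k≤j j<n le = byPosition (j ≤? m)
  where
  inPrefix : ∀ j → k ≤ j → j ≤ m → at w i ≤ at w j → at w i ≤ at w k × at w k ≤ at w j
  inPrefix j k≤j j≤m le =
    let ek = at-take (suc m) w (s≤s k≤m)
        ei = at-take (suc m) w (s≤s (≤-trans i≤k k≤m))
        ej = at-take (suc m) w (s≤s j≤m)
        l , r = ck i j i≤k k≤j (<-take⁺ (suc m) w (s≤s j≤m) (≤-<-trans j≤m m<n)) (subst₂ _≤_ (sym ei) (sym ej) le)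
    in subst₂ _≤_ ei ek l , subst₂ _≤_ ek ej r
  byPosition : Dec (j ≤ m) → at w i ≤ at w k × at w k ≤ at w j
  byPosition (yes j≤m) = inPrefix j k≤j j≤m le
  byPosition (no  j≰m) =
    let l , r   = cm i j (≤-trans i≤k k≤m) (<⇒≤ (≰⇒> j≰m)) j<n le
        l′ , r′ = inPrefix m k≤m ≤-refl l
    in l′ , ≤-trans r′ r

least : ∀ {p} {P : ℕ → Set p} → (∀ n → Dec (P n)) → ∀ {n} → P n → ∃ λ m → P m × m ≤ n × (∀ {j} → j < m → ¬ P j)
least {P = P} P? {n} pn with P? 0
... | yes p0 = 0 , p0 , z≤n , λ ()
least P? {zero}  pn | no ¬p0 = contradiction pn ¬p0
least P? {suc n} pn | no ¬p0 with m , pm , m≤n , below ← least (P? ∘ suc) pn =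
  suc m , pm , s≤s m≤n , λ { {zero} _ → ¬p0 ; {suc j} (s≤s j<m) → below j<m }

maxW-∈ : ∀ {w x} → x ∈ w → 1 ≤ x → maxW w ∈ w
maxW-∈ {w} x∈w 1≤x with foldr-selective ⊔-sel 0 w
... | inj₁ eq = contradiction (≤-trans 1≤x (subst (_ ≤_) eq (∈⇒≤maxW x∈w))) λ ()
... | inj₂ max∈w = max∈w

-- With `p` the letter at the cut, `a` is the least letter of the prefix and `c` the least one above
-- `p`, if any. Numbers in the claimed intervals occur in `u` because `u` has no gaps. One occurring
-- only after the cut is forced to be at least `p`, which leaves just `p` in the lower interval; in
-- the upper one the cut would force `c ≤ p`.
cut⇒secableAt : ∀ {u k} → IsPacked u → 1 ≤ k → suc k < length u → Cut u k → SecableAt u (suc k)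
cut⇒secableAt {u} {k} u-packed 1≤k sk<n cut
  with least (_∈? take (suc k) u) {at u k} (∈-take⁺ (suc k) u ≤-refl (<-trans ≤-refl sk<n))
... | a , a∈ , a≤p , a-min = s≤s 1≤k , sk<n , (a , a≤p , union) , onlyPivot
  where
  p = at u k
  pre = take (suc k) u
  k<n = <-trans ≤-refl sk<n
  p∈ : p ∈ pre
  p∈ = ∈-take⁺ (suc k) u ≤-refl k<n
  pre⊆u : ∀ {x} → x ∈ pre → x ∈ u
  pre⊆u x∈ with _ , _ , i<n , refl ← ∈-take⁻ (suc k) u x∈ = at-∈ u i<n
  a≤ : ∀ {x} → x ∈ pre → a ≤ x
  a≤ x∈ = ≮⇒≥ λ x<a → a-min x<a x∈
  1≤ : ∀ {x} → x ∈ pre → 1 ≤ x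
  1≤ = packed-≥1 u-packed ∘ pre⊆u
  -- A letter at least as large as a prefix letter is itself in the prefix, or the cut separates the
  -- two.
  above : ∀ {x y} → x ∈ pre → y ∈ u → x ≤ y → y ∈ pre ⊎ (x ≤ p × p ≤ y)
  above x∈ y∈ x≤y with i , i<sk , _ , refl ← ∈-take⁻ (suc k) u x∈ | j , j<n , refl ← ∈-at y∈ with j ≤? k
  ... | yes j≤k = inj₁ (∈-take⁺ (suc k) u (s≤s j≤k) j<n)
  ... | no  j≰k = inj₂ (cut i j (≤-pred i<sk) (<⇒≤ (≰⇒> j≰k)) j<n x≤y)
  low : ∀ {x} → InInterval a p x → x ∈ pre
  low (a≤x , x≤p) with above a∈ (packed-downward u-packed (pre⊆u p∈) (≤-trans (1≤ a∈) a≤x) x≤p) a≤x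
  ... | inj₁ x∈       = x∈
  ... | inj₂ (_ , p≤x) = subst (_∈ pre) (≤-antisym p≤x x≤p) p∈
  onlyPivot : ∀ x → x ∈ pre → x ∈ drop k u → x ≡ p
  onlyPivot x x∈ x∈′ with i , i<sk , _ , refl ← ∈-take⁻ (suc k) u x∈ | j , k≤j , j<n , eq ← ∈-drop⁻ k u x∈′ =
    let l , r = cut i j (≤-pred i<sk) k≤j j<n (≤-reflexive (sym eq))
    in ≤-antisym l (≤-trans r (≤-reflexive eq))
  union : (∀ x → (x ∈ pre) ⇔ InInterval a p x)
        ⊎ (∃ λ c → c ≤ maxW u × (∀ x → (x ∈ pre) ⇔ (InInterval a p x ⊎ InInterval c (maxW u) x)))
  union with Any.any? (p <?_) pre
  ... | no none = inj₁ λ x → mk⇔ (λ x∈ → a≤ x∈ , ≮⇒≥ λ p<x → none (Any.map (λ { refl → p<x }) x∈)) low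
  ... | yes some with y , y∈ , p<y ← find some
                 with c , (p<c , c∈) , _ , c-min ← least (λ c → (p <? c) ×-dec (c ∈? pre)) (p<y , y∈) =
    inj₂ (c , ∈⇒≤maxW (pre⊆u c∈) , λ x → mk⇔ to from)
    where
    to : ∀ {x} → x ∈ pre → InInterval a p x ⊎ InInterval c (maxW u) x
    to {x} x∈ with x ≤? p
    ... | yes x≤p = inj₁ (a≤ x∈ , x≤p)
    ... | no  x≰p = inj₂ ((≮⇒≥ λ x<c → c-min x<c (≰⇒> x≰p , x∈)) , ∈⇒≤maxW (pre⊆u x∈))
    from : ∀ {x} → InInterval a p x ⊎ InInterval c (maxW u) x → x ∈ pre
    from (inj₁ a≤x≤p) = low a≤x≤p
    from (inj₂ (c≤x , x≤max))
      with above c∈ (packed-downward u-packed (maxW-∈ (pre⊆u p∈) (1≤ p∈)) (≤-trans (1≤ c∈) c≤x) x≤max) c≤x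
    ... | inj₁ x∈        = x∈
    ... | inj₂ (c≤p , _) = contradiction c≤p (<⇒≱ p<c)

-- A letter `u_j` from the suffix that falls in one of the intervals is also a prefix letter, hence
-- equals the pivot. The pair is then compared through the pivot.
secableAt⇒cut : ∀ {u k} → SecableAt u (suc k) → Cut u k
secableAt⇒cut {u} {k} (_ , sk<n , (a , a≤p , union) , onlyPivot) i j i≤k k≤j j<n le = case union
  where
  p = at u k
  i∈ : at u i ∈ take (suc k) u
  i∈ = ∈-take⁺ (suc k) u (s≤s i≤k) (≤-<-trans i≤k (<-trans ≤-refl sk<n))
  j≡p : at u j ∈ take (suc k) u → at u j ≡ p
  j≡p j∈ = onlyPivot _ j∈ (∈-drop⁺ k u k≤j j<n)
  pivotAtMost : at u i ≤ p → (InInterval a p (at u j) → at u j ∈ take (suc k) u) → a ≤ at u i → at u i ≤ p × p ≤ at u j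
  pivotAtMost i≤p low a≤i with at u j ≤? p
  ... | yes j≤p = i≤p , ≤-reflexive (sym (j≡p (low (≤-trans a≤i le , j≤p))))
  ... | no  j≰p = i≤p , <⇒≤ (≰⇒> j≰p)
  case : ((∀ x → (x ∈ take (suc k) u) ⇔ InInterval a p x)
        ⊎ (∃ λ c → c ≤ maxW u × (∀ x → (x ∈ take (suc k) u) ⇔ (InInterval a p x ⊎ InInterval c (maxW u) x)))) →
        at u i ≤ p × p ≤ at u j
  case (inj₁ iff) = let a≤i , i≤p = Equivalence.to (iff _) i∈ in pivotAtMost i≤p (Equivalence.from (iff _)) a≤i
  case (inj₂ (c , _ , iff)) with Equivalence.to (iff _) i∈
  ... | inj₁ (a≤i , i≤p) = pivotAtMost i≤p (Equivalence.from (iff _) ∘ inj₁) a≤i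
  -- Above `c` every letter up to the maximum is in the prefix, so `u_j` is the pivot.
  ... | inj₂ (c≤i , _) =
    let eq = j≡p (Equivalence.from (iff _) (inj₂ (≤-trans c≤i le , ∈⇒≤maxW (at-∈ u j<n))))
    in subst (at u i ≤_) eq le , ≤-reflexive (sym eq)

-- Factorization into non-secable words

-- Successive factors share the letter at `k`, as in the product `#`. Factors in the list matter up
-- to order type, whereas the rest `drop k w` is kept unpacked.
data Glued : List Word → Word → Set where
  unit : ∀ {w} → length w ≡ 1 → Glued [] w
  _⟨_,_,_⟩∷_ : ∀ {u us w k} → length u ≡ suc k → k < length w → take (suc k) w ≃ u → Cut w k → Glued us (drop k w) →
    Glued (u ∷ us) w

glued-≃ : ∀ {us v w} → v ≃ w → Glued us v → Glued us w
glued-≃ (p , q) (unit eq) = unit (trans (len q) eq)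
glued-≃ v≃w@(p , q) (_⟨_,_,_⟩∷_ {k = k} eq k<n pre cut suf) =
  eq ⟨ subst (k <_) (len p) k<n , ≃-trans (≃-take (suc k) (≃-sym v≃w)) pre , cut-≃ v≃w cut ⟩∷ glued-≃ (≃-drop k v≃w) suf

glued-≥1 : ∀ {us w} → Glued us w → 1 ≤ length w
glued-≥1 (unit eq) = ≤-reflexive (sym eq)
glued-≥1 (_ ⟨ k<n , _ , _ ⟩∷ _) = ≤-trans (s≤s z≤n) k<n

nonSecable-≥2 : ∀ {u k} → NonSecable u → length u ≡ suc k → 1 ≤ k
nonSecable-≥2 (_ , 2≤n , _) eq = ≤-pred (subst (2 ≤_) eq 2≤n)

-- If the first cuts differed, the earlier one would lie strictly inside the longer first factor and
-- make it secable.
glued-unique : ∀ {us us′ w} → All NonSecable us → All NonSecable us′ → Glued us w → Glued us′ w → us ≡ us′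
glued-unique _ _ (unit _) (unit _) = refl
glued-unique _ (ns ∷ _) (unit eq′) (eq ⟨ k<n , _ , _ ⟩∷ _) =
  contradiction (<-≤-trans k<n (≤-reflexive eq′)) (≤⇒≯ (nonSecable-≥2 ns eq))
glued-unique (ns ∷ _) _ (eq ⟨ k<n , _ , _ ⟩∷ _) (unit eq′) =
  contradiction (<-≤-trans k<n (≤-reflexive eq′)) (≤⇒≯ (nonSecable-≥2 ns eq))
glued-unique {w = w} (ns ∷ nss) (ns′ ∷ nss′)
  (_⟨_,_,_⟩∷_ {k = k} eq k<n pre cut suf) (_⟨_,_,_⟩∷_ {k = k′} eq′ k′<n pre′ cut′ suf′) with <-cmp k k′
... | tri≈ _ refl _ = cong₂ _∷_ (packed-≃⇒≡ (proj₁ ns) (proj₁ ns′) (≃-trans (≃-sym pre) pre′)) (glued-unique nss nss′ suf suf′)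
... | tri< k<k′ _ _ = contradiction (suc k , inner) (proj₂ (proj₂ ns′))
  where inner = cut⇒secableAt (proj₁ ns′) (nonSecable-≥2 ns eq) (subst (suc k <_) (sym eq′) (s≤s k<k′))
                  (cut-≃ pre′ (cut-take {w = w} (suc k′) cut))
... | tri> _ _ k′<k = contradiction (suc k′ , inner) (proj₂ (proj₂ ns))
  where inner = cut⇒secableAt (proj₁ ns) (nonSecable-≥2 ns′ eq′) (subst (suc k′ <_) (sym eq) (s≤s k′<k))
                  (cut-≃ pre (cut-take {w = w} (suc k) cut′))

-- Cutting at the first cut after position 0 gives a non-secable prefix, since by `cut-untake` an
-- inner cut of the prefix would be an earlier cut of `w`. The suffix is shorter.
factorize : ∀ w → 1 ≤ length w → ∃ λ us → All NonSecable us × Glued us w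
factorize w 1≤n = go w 1≤n (<-wellFounded (length w))
  where
  go : ∀ w → 1 ≤ length w → Acc _<_ (length w) → ∃ λ us → All NonSecable us × Glued us w
  go (x ∷ [])     _ _ = [] , [] , unit refl
  go w@(x ∷ y ∷ w′) _ (acc smaller)
    -- Shifting by `suc` skips position 0, which is always a cut.
    with k′ , cut , k′≤ , minimal ← least (cut? w ∘ suc) {length w′} (cut-last w refl) =
    let k   = suc k′
        k<n : k < length w
        k<n = s≤s (s≤s k′≤)
        pre = take (suc k) w
        u   = pack pre
        u-len : length u ≡ suc k
        u-len = trans (length-pack pre) (length-take-≤ (suc k) w k<n)
        nonSecable : ¬ Secable u
        nonSecable = λ
          -- Secability at `m′ + 2` is a cut at position `m′ + 1`, which has index `m′` in the
          -- shifted search.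
          { (suc (suc m′) , sec@(_ , m<n , _)) →
              minimal (≤-pred (≤-pred (subst (suc (suc m′) <_) u-len m<n)))
                (cut-untake (≤-pred (<⇒≤ (subst (suc (suc m′) <_) u-len m<n))) k<n cut
                  (cut-≃ (pack-≃ pre) (secableAt⇒cut sec)))
          ; (suc zero , s≤s () , _)
          ; (zero , () , _) }
        shorter : length (drop k w) < length w
        shorter = subst (_< length w) (sym (length-drop k w)) (s≤s (m∸n≤m (suc (length w′)) k′))
        us , nss , suf = go (drop k w) (subst (1 ≤_) (sym (length-drop k w)) (m<n⇒0<n∸m k<n)) (smaller shorter)
    in u ∷ us , (pack-packed pre , subst (2 ≤_) (sym u-len) (s≤s (s≤s z≤n)) , nonSecable) ∷ nss ,
       (u-len ⟨ k<n , ≃-sym (pack-≃ pre) , cut ⟩∷ suf)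

-- The maximal word with given factors

-- Moves the letters below and above a pivot into separate bands, so that two words can be
-- relabelled to share their pivot and interleave as wanted.
piece : ℕ → ℕ → ℕ → ℕ → ℕ → ℕ
piece p a b c x with <-cmp x p
... | tri< _ _ _ = a + x
... | tri≈ _ _ _ = b
... | tri> _ _ _ = c + x

piece-mono-< : ∀ {p a b c x y} → a + p ≤ b → b ≤ c + p → x < y → piece p a b c x < piece p a b c y
piece-mono-< {p} {a} {b} {c} {x} {y} a+p≤b b≤c+p x<y with <-cmp x p | <-cmp y p
... | tri< x<p _ _ | tri< y<p _ _ = +-monoʳ-< a x<y
... | tri< x<p _ _ | tri≈ _ _ _   = <-≤-trans (+-monoʳ-< a x<p) a+p≤b
... | tri< x<p _ _ | tri> _ _ p<y = <-trans (<-≤-trans (+-monoʳ-< a x<p) a+p≤b) (≤-<-trans b≤c+p (+-monoʳ-< c p<y))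
... | tri≈ _ refl _ | tri< y<p _ _ = contradiction x<y (<⇒≯ y<p)
... | tri≈ _ refl _ | tri≈ _ refl _ = contradiction x<y (<-irrefl refl)
... | tri≈ _ _ _   | tri> _ _ p<y = ≤-<-trans b≤c+p (+-monoʳ-< c p<y)
... | tri> _ _ p<x | tri< y<p _ _ = contradiction (<-trans x<y y<p) (<⇒≯ p<x)
... | tri> _ _ p<x | tri≈ _ refl _ = contradiction x<y (<⇒≯ p<x)
... | tri> _ _ p<x | tri> _ _ p<y = +-monoʳ-< c x<y

piece-pivot : ∀ p a b c → piece p a b c p ≡ b
piece-pivot p a b c with <-cmp p p
... | tri< _ p≢p _ = contradiction refl p≢p
... | tri≈ _ _ _   = refl
... | tri> _ p≢p _ = contradiction refl p≢p

strict⇒mono-≤ : ∀ {f : ℕ → ℕ} → (∀ {x y} → x < y → f x < f y) → ∀ {x y} → x ≤ y → f x ≤ f y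
strict⇒mono-≤ f-mono {x} {y} x≤y with m≤n⇒m<n∨m≡n x≤y
... | inj₁ x<y  = <⇒≤ (f-mono x<y)
... | inj₂ refl = ≤-refl

-- In the glued word the letters are ordered by: letters of v below its first letter, letters of u below its last
-- letter, the common pivot, letters of v above the pivot, letters of u above the pivot.
module Join (u v : Word) (k : ℕ) where
  B p q : ℕ
  -- Exceeds all letters of both words, so the bands starting at `0`, `B`, `2B`, `3B` do not
  -- overlap; the pivot becomes `2B`.
  B = suc (maxW u + maxW v)
  p = at u k
  q = at v 0

  φ ψ : ℕ → ℕ
  φ = piece p B (B + B) (B + B + B)
  ψ = piece q 0 (B + B) (B + B)

  joined : Word
  joined = map φ (take k u) ++ map ψ v

  module _ (eq : length u ≡ suc k) (1≤v : 1 ≤ length v) where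
    k<u : k < length u
    k<u = ≤-reflexive (sym eq)

    p<B : p < B
    p<B = s≤s (≤-trans (∈⇒≤maxW (at-∈ u k<u)) (m≤m+n (maxW u) (maxW v)))

    ∈v⇒<B : ∀ {y} → y ∈ v → y < B
    ∈v⇒<B y∈v = s≤s (≤-trans (∈⇒≤maxW y∈v) (m≤n+m (maxW v) (maxW u)))

    q<B : q < B
    q<B = ∈v⇒<B (at-∈ v 1≤v)

    φ-mono : ∀ {x y} → x < y → φ x < φ y
    φ-mono = piece-mono-< {p} {B} (+-monoʳ-≤ B (<⇒≤ p<B)) (≤-trans (m≤m+n (B + B) B) (m≤m+n (B + B + B) p))

    ψ-mono : ∀ {x y} → x < y → ψ x < ψ y
    ψ-mono = piece-mono-< {q} {0} (≤-trans (<⇒≤ q<B) (m≤m+n B B)) (m≤m+n (B + B) q)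

    map-strict-≃ : ∀ {f : ℕ → ℕ} w → (∀ {x y} → x < y → f x < f y) → map f w ≃ w
    map-strict-≃ w f-mono = map-↝ w (λ _ _ → f-mono) , ↝-map w (λ _ _ → strict⇒mono-≤ f-mono)

    take-length : length (map φ (take k u)) ≡ k
    take-length = trans (length-map φ (take k u)) (length-take-≤ k u (<⇒≤ k<u))

    joined-length : length joined ≡ k + length v
    joined-length = trans (length-++ (map φ (take k u))) (cong₂ _+_ take-length (length-map ψ v))

    k<joined : k < length joined
    k<joined = subst (k <_) (sym joined-length) (m<m+n k 1≤v)

    at-suffix : ∀ {i} → i < length v → at joined (k + i) ≡ ψ (at v i)
    at-suffix {i} i<n = trans
      (subst (λ l → at joined (l + i) ≡ at (map ψ v) i) take-length (at-++ʳ (map φ (take k u)) (map ψ v) i))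
      (at-map ψ v i<n)

    at-pivot : at joined k ≡ B + B
    at-pivot = trans (trans (cong (at joined) (sym (+-identityʳ k))) (at-suffix 1≤v)) (piece-pivot q 0 (B + B) (B + B))

    at-prefix : ∀ {i} → i ≤ k → at joined i ≡ φ (at u i)
    at-prefix {i} i≤k with m≤n⇒m<n∨m≡n i≤k
    -- The pivot letter of `joined` is taken from `v`, but `φ` and `ψ` agree there.
    ... | inj₂ refl = trans at-pivot (sym (piece-pivot p B (B + B) (B + B + B)))
    ... | inj₁ i<k  =
      let i<u = <-trans i<k k<u
      in trans (at-++ˡ (map φ (take k u)) (map ψ v) (subst (i <_) (sym take-length) i<k))
           (trans (at-map φ (take k u) (<-take⁺ k u i<k i<u)) (cong φ (at-take k u i<k)))

    prefix-≡ : take (suc k) joined ≡ map φ u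
    prefix-≡ = at-ext (trans (length-take-≤ (suc k) joined k<joined) (trans (sym eq) (sym (length-map φ u)))) λ {i} i< →
      let i<sk = proj₁ (<-take⁻ (suc k) joined i<)
      in trans (at-take (suc k) joined i<sk)
           (trans (at-prefix (≤-pred i<sk)) (sym (at-map φ u (subst (i <_) (sym eq) i<sk))))

    suffix-≡ : drop k joined ≡ map ψ v
    suffix-≡ = at-ext
      (trans (length-drop k joined) (trans (cong (_∸ k) joined-length) (trans (m+n∸m≡n k (length v)) (sym (length-map ψ v)))))
      λ {i} i< →
        let i<v = +-cancelˡ-< k i (length v) (subst (k + i <_) joined-length (<-drop⁻ k joined i<))
        in trans (at-drop k joined i) (trans (at-suffix i<v) (sym (at-map ψ v i<v)))

    -- A value of `ψ` below `2B` is below `B`, hence under every value of `φ`; a value of `φ` above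
    -- `2B` is at least `3B`, hence over every value of `ψ`.
    pivot-between : ∀ {x y} → y < B → φ x ≤ ψ y → φ x ≤ B + B × B + B ≤ ψ y
    pivot-between {x} {y} y<B le with <-cmp x p | <-cmp y q
    ... | tri< _ _ _ | tri< _ _ _ = contradiction (≤-trans (m≤m+n B x) le) (<⇒≱ y<B)
    ... | tri≈ _ _ _ | tri< _ _ _ = contradiction (≤-trans (m≤m+n B B) le) (<⇒≱ y<B)
    ... | tri> _ _ _ | tri< _ _ _ =
      contradiction (≤-trans (≤-trans (m≤m+n B B) (≤-trans (m≤m+n (B + B) B) (m≤m+n (B + B + B) x))) le) (<⇒≱ y<B)
    ... | tri< x<p _ _ | tri≈ _ _ _ = le , ≤-refl
    ... | tri≈ _ _ _   | tri≈ _ _ _ = le , ≤-refl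
    ... | tri> _ _ _   | tri≈ _ _ _ = le , ≤-refl
    ... | tri< x<p _ _ | tri> _ _ _ = +-monoʳ-≤ B (<⇒≤ (<-trans x<p p<B)) , m≤m+n (B + B) y
    ... | tri≈ _ _ _   | tri> _ _ _ = ≤-refl , m≤m+n (B + B) y
    ... | tri> _ _ _   | tri> _ _ _ =
      contradiction (≤-trans (m≤m+n (B + B + B) x) le) (<⇒≱ (+-monoʳ-< (B + B) y<B))

    joined-cut : Cut joined k
    joined-cut i j i≤k k≤j j<n le with j′ , refl ← m≤n⇒∃[o]m+o≡n k≤j =
      let j′<v = +-cancelˡ-< k j′ (length v) (subst (k + j′ <_) joined-length j<n)
          ei = at-prefix i≤k
          ej = at-suffix j′<v
          l , r = pivot-between {at u i} (∈v⇒<B (at-∈ v j′<v)) (subst₂ _≤_ ei ej le)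
      in subst₂ _≤_ (sym ei) (sym at-pivot) l , subst₂ _≤_ (sym at-pivot) (sym ej) r

    joined-glued : ∀ {us} → Glued us v → Glued (u ∷ us) joined
    joined-glued gv = eq ⟨ k<joined , ≃-trans (≡⇒≃ prefix-≡) (map-strict-≃ u φ-mono) , joined-cut ⟩∷
      glued-≃ (≃-sym (≃-trans (≡⇒≃ suffix-≡) (map-strict-≃ v ψ-mono))) gv

-- By `top-glued` and `glued-unique`, `top us` has `us` as its only factorization when `us` consists
-- of non-secable words.
top : List Word → Word
top []       = 1 ∷ []
top (u ∷ us) = Join.joined u (top us) (pred (length u))

top-glued : ∀ {us} → All NonSecable us → Glued us (top us)
top-glued []                          = unit refl
top-glued {u ∷ us} ((_ , 2≤n , _) ∷ nss) =
  Join.joined-glued u (top us) (pred (length u)) (length≡suc u 2≤n) (glued-≥1 (top-glued nss)) (top-glued nss)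
  where
  length≡suc : ∀ (w : Word) → 2 ≤ length w → length w ≡ suc (pred (length w))
  length≡suc (_ ∷ _) _ = refl

-- The pseudo-permutohedron order

-- The pseudo-permutohedron order, extended to unpacked words: the doubled coefficient of a pair is
-- at most 1 for `≤` and 0 for `<`, so both relations pass from the larger word `w` to `v`.
record _⊑_ (v w : Word) : Set where
  field
    len    : length v ≡ length w
    ≤-pres : ∀ {i j} → i < j → j < length w → at w i ≤ at w j → at v i ≤ at v j
    <-pres : ∀ {i j} → i < j → j < length w → at w i < at w j → at v i < at v j

open _⊑_

≃⇒⊑ : ∀ {v w} → v ≃ w → v ⊑ w
≃⇒⊑ (p , q) = record
  { len    = len p
  ; ≤-pres = λ i<j j<n → mono q (<-trans i<j j<n) j<n
  ; <-pres = λ i<j j<n → ↝-strict p (<-trans i<j j<n) j<n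
  }

⊑-trans : ∀ {u v w} → u ⊑ v → v ⊑ w → u ⊑ w
⊑-trans p q = record
  { len    = trans (len p) (len q)
  ; ≤-pres = λ i<j j<n → ≤-pres p i<j (subst (_ <_) (sym (len q)) j<n) ∘ ≤-pres q i<j j<n
  ; <-pres = λ i<j j<n → <-pres p i<j (subst (_ <_) (sym (len q)) j<n) ∘ <-pres q i<j j<n
  }

-- Pairs `i < j` use `≤-pres` of one comparison, pairs `j < i` the contrapositive of `<-pres` of the
-- other.
⊑-antisym : ∀ {v w} → v ⊑ w → w ⊑ v → v ≃ w
⊑-antisym p q = half p q , half q p
  where
  half : ∀ {v w} → v ⊑ w → w ⊑ v → v ↝ w
  half p q = record { len = len p ; mono = λ {i} {j} i<n j<n le → case (<-cmp i j) i<n j<n le }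
    where
    case : ∀ {i j} → _ → i < _ → j < _ → _ → _
    case (tri< i<j _ _) i<n j<n le = ≤-pres q i<j j<n le
    case (tri≈ _ refl _) i<n j<n le = ≤-refl
    case (tri> _ _ j<i) i<n j<n le = ≮⇒≥ (λ lt → ≤⇒≯ le (<-pres p j<i (subst (_ <_) (len p) i<n) lt))

-- This is the maximality of a word with a cut. A comparison across `k` in `w` passes through `w_k`,
-- so it splits into two comparisons, each inside one factor and each inherited by `v`.
⊑-glue : ∀ {v w k} → k < length v → k < length w → Cut w k →
  take (suc k) v ⊑ take (suc k) w → drop k v ⊑ drop k w → v ⊑ w
⊑-glue {v} {w} {k} k<v k<w cut pre suf = record
  { len    = ∸-cancelʳ-≡ (<⇒≤ k<v) (<⇒≤ k<w) (trans (sym (length-drop k v)) (trans (len suf) (length-drop k w)))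
  ; ≤-pres = ≤-glue
  ; <-pres = <-glue
  }
  where
  inPrefix : (R : ℕ → ℕ → Set) → (∀ {i j} → i < j → j < length (take (suc k) w) →
               R (at (take (suc k) w) i) (at (take (suc k) w) j) → R (at (take (suc k) v) i) (at (take (suc k) v) j)) →
             ∀ {i j} → i < j → j ≤ k → R (at w i) (at w j) → R (at v i) (at v j)
  inPrefix R pres i<j j≤k r =
    let j<sk = s≤s j≤k
        i<sk = <-trans i<j j<sk
    in subst₂ R (at-take (suc k) v i<sk) (at-take (suc k) v j<sk)
         (pres i<j (<-take⁺ (suc k) w j<sk (≤-<-trans j≤k k<w))
           (subst₂ R (sym (at-take (suc k) w i<sk)) (sym (at-take (suc k) w j<sk)) r))

  inSuffix : (R : ℕ → ℕ → Set) → (∀ {i j} → i < j → j < length (drop k w) →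
               R (at (drop k w) i) (at (drop k w) j) → R (at (drop k v) i) (at (drop k v) j)) →
             ∀ {i j} → i < j → k ≤ i → j < length w → R (at w i) (at w j) → R (at v i) (at v j)
  inSuffix R pres i<j k≤i j<n r
    with i′ , refl ← m≤n⇒∃[o]m+o≡n k≤i | j′ , refl ← m≤n⇒∃[o]m+o≡n (≤-trans k≤i (<⇒≤ i<j)) =
    subst₂ R (at-drop k v i′) (at-drop k v j′)
      (pres (+-cancelˡ-< k i′ j′ i<j) (<-drop⁺ k w j<n)
        (subst₂ R (sym (at-drop k w i′)) (sym (at-drop k w j′)) r))

  ≤-glue : ∀ {i j} → i < j → j < length w → at w i ≤ at w j → at v i ≤ at v j
  ≤-glue {i} {j} i<j j<n le with j ≤? k | k ≤? i
  ... | yes j≤k | _       = inPrefix _≤_ (≤-pres pre) i<j j≤k le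
  ... | no  _   | yes k≤i = inSuffix _≤_ (≤-pres suf) i<j k≤i j<n le
  ... | no  j≰k | no  k≰i =
    let i<k = ≰⇒> k≰i
        k<j = ≰⇒> j≰k
        l , r = cut i j (<⇒≤ i<k) (<⇒≤ k<j) j<n le
    in ≤-trans (inPrefix _≤_ (≤-pres pre) i<k ≤-refl l) (inSuffix _≤_ (≤-pres suf) k<j ≤-refl j<n r)

  <-glue : ∀ {i j} → i < j → j < length w → at w i < at w j → at v i < at v j
  <-glue {i} {j} i<j j<n lt with j ≤? k | k ≤? i
  ... | yes j≤k | _       = inPrefix _<_ (<-pres pre) i<j j≤k lt
  ... | no  _   | yes k≤i = inSuffix _<_ (<-pres suf) i<j k≤i j<n lt
  ... | no  j≰k | no  k≰i
    with i<k ← ≰⇒> k≰i | k<j ← ≰⇒> j≰k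
    with l , r ← cut i j (<⇒≤ i<k) (<⇒≤ k<j) j<n (<⇒≤ lt)
    with m≤n⇒m<n∨m≡n l
  -- At least one of the two halves of `w_i < w_j` is strict.
  ... | inj₁ l< = <-≤-trans (inPrefix _<_ (<-pres pre) i<k ≤-refl l<) (inSuffix _≤_ (≤-pres suf) k<j ≤-refl j<n r)
  ... | inj₂ l≡ = ≤-<-trans (inPrefix _≤_ (≤-pres pre) i<k ≤-refl l)
                    (inSuffix _<_ (<-pres suf) k<j ≤-refl j<n (subst (_< at w j) l≡ lt))

-- `coef2 w i j` is definitionally `coef (at w i) (at w j)`.
coef : ℕ → ℕ → ℕ
coef x y = if y <ᵇ x then 2 else (if x ≡ᵇ y then 1 else 0)

coef-< : ∀ {x y} → x < y → coef x y ≡ 0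
coef-< {x} {y} x<y with y <ᵇ x in gt | x ≡ᵇ y in eq
... | true  | _     = contradiction (<ᵇ⇒< y x (subst T (sym gt) _)) (<⇒≯ x<y)
... | false | true  = contradiction (≡ᵇ⇒≡ x y (subst T (sym eq) _)) (<⇒≢ x<y)
... | false | false = refl

coef-≡ : ∀ x → coef x x ≡ 1
coef-≡ x with x <ᵇ x in gt | x ≡ᵇ x in eq
... | true  | _     = contradiction (<ᵇ⇒< x x (subst T (sym gt) _)) (<-irrefl refl)
... | false | true  = refl
... | false | false = ⊥-elim (subst T eq (≡⇒≡ᵇ x x refl))

coef-> : ∀ {x y} → y < x → coef x y ≡ 2
coef-> {x} {y} y<x with y <ᵇ x in gt
... | true  = refl
... | false = ⊥-elim (subst T gt (<⇒<ᵇ y<x))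

coef-≤1⇒≤ : ∀ {x y} → coef x y ≤ 1 → x ≤ y
coef-≤1⇒≤ {x} {y} c≤1 = ≮⇒≥ λ y<x → contradiction (subst (_≤ 1) (coef-> y<x) c≤1) λ { (s≤s ()) }

coef-≤0⇒< : ∀ {x y} → coef x y ≤ 0 → x < y
coef-≤0⇒< {x} {y} c≤0 = ≤∧≢⇒< (coef-≤1⇒≤ (≤-trans c≤0 z≤n))
  λ { refl → contradiction (subst (_≤ 0) (coef-≡ x) c≤0) λ () }

≤⇒coef-≤1 : ∀ {x y} → x ≤ y → coef x y ≤ 1
≤⇒coef-≤1 {x} x≤y with m≤n⇒m<n∨m≡n x≤y
... | inj₁ x<y  = ≤-trans (≤-reflexive (coef-< x<y)) z≤n
... | inj₂ refl = ≤-reflexive (coef-≡ x)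

coef-≤2 : ∀ x y → coef x y ≤ 2
coef-≤2 x y with x ≤? y
... | yes x≤y = ≤-trans (≤⇒coef-≤1 x≤y) (n≤1+n 1)
... | no  x≰y = ≤-reflexive (coef-> (≰⇒> x≰y))

coef2-≤⇒⊑ : ∀ {v w} → length v ≡ length w → (∀ {i j} → i < j → j < length w → coef2 v i j ≤ coef2 w i j) → v ⊑ w
coef2-≤⇒⊑ eq c≤ = record
  { len    = eq
  ; ≤-pres = λ i<j j<n le → coef-≤1⇒≤ (≤-trans (c≤ i<j j<n) (≤⇒coef-≤1 le))
  ; <-pres = λ i<j j<n lt → coef-≤0⇒< (≤-trans (c≤ i<j j<n) (≤-reflexive (coef-< lt)))
  }

⊑⇒coef2-≤ : ∀ {v w} → v ⊑ w → ∀ {i j} → i < j → j < length w → coef2 v i j ≤ coef2 w i j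
⊑⇒coef2-≤ {v} {w} p {i} {j} i<j j<n with <-cmp (at w i) (at w j)
... | tri< lt _ _ = ≤-trans (≤-reflexive (coef-< (<-pres p i<j j<n lt))) z≤n
... | tri≈ _ eq _ = ≤-trans (≤⇒coef-≤1 (≤-pres p i<j j<n (≤-reflexive eq)))
                      (≤-reflexive (sym (trans (cong (coef (at w i)) (sym eq)) (coef-≡ (at w i)))))
... | tri> _ _ gt = ≤-trans (coef-≤2 (at v i) (at v j)) (≤-reflexive (sym (coef-> gt)))

allB⁻ : ∀ {A : Set} {p : A → _} xs → T (allB p xs) → ∀ {x} → x ∈ xs → T (p x)
allB⁻ (x ∷ xs) t (here refl) = proj₁ (Equivalence.to T-∧ t)
allB⁻ (x ∷ xs) t (there x∈)  = allB⁻ xs (proj₂ (Equivalence.to T-∧ t)) x∈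

allB⁺ : ∀ {A : Set} {p : A → _} xs → (∀ {x} → x ∈ xs → T (p x)) → T (allB p xs)
allB⁺ []       _ = _
allB⁺ (x ∷ xs) t = Equivalence.from T-∧ (t (here refl) , allB⁺ xs (t ∘ there))

≤PPᵇ⇒⊑ : ∀ {v w} → T (v ≤PPᵇ w) → v ⊑ w
≤PPᵇ⇒⊑ {v} {w} t =
  let teq , tall = Equivalence.to T-∧ t
      eq = ≡ᵇ⇒≡ (length v) (length w) teq
  in coef2-≤⇒⊑ eq λ {i} {j} i<j j<n → ≤ᵇ⇒≤ _ _
       (allB⁻ (upTo j) (allB⁻ (upTo (length v)) tall (∈-upTo⁺ (subst (j <_) (sym eq) j<n))) (∈-upTo⁺ i<j))

≤PPᵇ-refl : ∀ w → T (w ≤PPᵇ w)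
≤PPᵇ-refl w = Equivalence.from T-∧
  (≡⇒≡ᵇ (length w) (length w) refl , allB⁺ (upTo (length w)) λ {j} _ → allB⁺ (upTo j) λ {i} _ → ≤⇒≤ᵇ {coef2 w i j} ≤-refl)

-- A rank function for the order

sum-mono-≤ : ∀ {f g : ℕ → ℕ} xs → (∀ {x} → x ∈ xs → f x ≤ g x) → sum (map f xs) ≤ sum (map g xs)
sum-mono-≤ []       _   = z≤n
sum-mono-≤ (x ∷ xs) f≤g = +-mono-≤ (f≤g (here refl)) (sum-mono-≤ xs (f≤g ∘ there))

-- A single strict inequality between terms would make the totals strictly unequal.
sum-≥⇒≥ : ∀ {f g : ℕ → ℕ} xs → (∀ {x} → x ∈ xs → f x ≤ g x) → sum (map g xs) ≤ sum (map f xs) →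
  ∀ {x} → x ∈ xs → g x ≤ f x
sum-≥⇒≥ {f} {g} (x ∷ xs) f≤g sum≥ (here refl) =
  +-cancelʳ-≤ (sum (map f xs)) (g x) (f x) (≤-trans (+-monoʳ-≤ (g x) (sum-mono-≤ xs (f≤g ∘ there))) sum≥)
sum-≥⇒≥ {f} {g} (y ∷ xs) f≤g sum≥ (there x∈) = sum-≥⇒≥ xs (f≤g ∘ there)
  (+-cancelˡ-≤ (f y) _ _ (≤-trans (+-monoˡ-≤ (sum (map g xs)) (f≤g (here refl))) sum≥)) x∈

-- Twice the number of inversions plus the number of ties; it is the measure for the inductions
-- along `⊑`.
inversions : Word → ℕ
inversions w = sum (map (λ j → sum (map (λ i → coef2 w i j) (upTo j))) (upTo (length w)))

-- Otherwise `sum-≥⇒≥`, applied to the outer and then the inner sum, reverses the inequality of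
-- every coefficient, and antisymmetry makes the order types equal.
⊑⇒inversions-< : ∀ {v w} → v ⊑ w → ¬ v ≃ w → inversions v < inversions w
⊑⇒inversions-< {v} {w} p v≄w = ≰⇒> λ ge → v≄w (⊑-antisym p (coef2-≤⇒⊑ (sym (len p)) λ {i} {j} i<j j<n →
  let ge′   = subst (λ n → inversions w ≤ sum (map (λ j → sum (map (λ i → coef2 v i j) (upTo j))) (upTo n))) (len p) ge
      j∈    = ∈-upTo⁺ (subst (j <_) (len p) j<n)
  in sum-≥⇒≥ (upTo j) (λ i∈ → ⊑⇒coef2-≤ p (∈-upTo⁻ i∈) (∈-upTo⁻ j∈)) 
       (sum-≥⇒≥ (upTo (length w)) (λ j∈ → sum-mono-≤ _ λ i∈ → ⊑⇒coef2-≤ p (∈-upTo⁻ i∈) (∈-upTo⁻ j∈)) ge′ j∈) (∈-upTo⁺ i<j)))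

-- Enumeration of packed words

allWords-length : ∀ n {m w} → w ∈ allWords n m → length w ≡ n
allWords-length zero    (here refl) = refl
allWords-length (suc n) {m} w∈
  with ws , w∈ws , ws∈ ← ∈-concat⁻′ (map (λ x → map (x ∷_) (allWords n m)) (map suc (upTo m))) w∈
  with x , _ , refl ← ∈-map⁻ (λ x → map (x ∷_) (allWords n m)) ws∈
  with v , v∈ , refl ← ∈-map⁻ (x ∷_) w∈ws = cong suc (allWords-length n v∈)

allWords-∈ : ∀ {m} w → (∀ {x} → x ∈ w → 1 ≤ x × x ≤ m) → w ∈ allWords (length w) m
allWords-∈ []      _      = here refl
allWords-∈ {m} (zero ∷ w) bounds = contradiction (proj₁ (bounds (here refl))) λ ()
allWords-∈ {m} (suc x ∷ w) bounds = ∈-concat⁺′ (∈-map⁺ (suc x ∷_) (allWords-∈ w (bounds ∘ there)))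
  (∈-map⁺ (λ x → map (x ∷_) (allWords (length w) m)) (∈-map⁺ suc (∈-upTo⁺ (proj₂ (bounds (here refl))))))

allWords-unique : ∀ n m → Unique (allWords n m)
allWords-unique zero    m = [] ∷ []
allWords-unique (suc n) m = Unique.concat⁺
  (All.map⁺ (All.tabulate λ _ → Unique.map⁺ (λ { refl → refl }) (allWords-unique n m)))
  (AllPairs.map⁺ (AllPairs.map disjoint (Unique.map⁺ suc-injective (Unique.upTo⁺ m))))
  where
  disjoint : ∀ {x y} → x ≢ y → Disjoint (map (x ∷_) (allWords n m)) (map (y ∷_) (allWords n m))
  disjoint {x} {y} x≢y (w∈ , w∈′) with _ , _ , refl ← ∈-map⁻ (x ∷_) w∈ | _ , _ , refl ← ∈-map⁻ (y ∷_) w∈′ = x≢y refl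

packedWords-unique : ∀ n → Unique (packedWords n)
packedWords-unique n = Unique.filter⁺ (λ w → ≡-dec _≟_ (pack w) w) (allWords-unique n n)

-- The alphabet bound holds because a letter is one more than the number of distinct smaller
-- letters, and those leave out the letter itself.
packedWords-∈ : ∀ {u} → IsPacked u → u ∈ packedWords (length u)
packedWords-∈ {u} u-packed = ∈-filter⁺ (λ w → ≡-dec _≟_ (pack w) w)
  (allWords-∈ u λ x∈u → packed-≥1 u-packed x∈u ,
    subst (_≤ length u) (sym (packed-rankIn u-packed x∈u))
      (≤-trans (s≤s (unique-⊆⇒length-≤ (deduplicate-! _) (∈-deduplicate⁻ _≟_ (filter (_<? _) u))))
        (filter-notAll (_<? _) u (Any.map (λ { refl → <-irrefl refl }) x∈u))))
  u-packed

packedWords⁻ : ∀ {n u} → u ∈ packedWords n → length u ≡ n × IsPacked u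
packedWords⁻ {n} u∈ = let u∈all , u-packed = ∈-filter⁻ (λ w → ≡-dec _≟_ (pack w) w) u∈ in allWords-length n u∈all , u-packed

-- Free generation by unitriangular families

module FreeGeneration {c ℓ : Level} (K : Field c ℓ) where
  open WQSymDefs K
  private module F = Field K
  open F using (Carrier; _≈_; 0#; 1#) renaming (_+_ to _⊕_; _*_ to _⊛_; -_ to ⊖_)
  open import Relation.Binary.Reasoning.Setoid F.setoid

  -- Finite sums and values of products

  sumK-cong : ∀ {a} {A : Set a} {f g : A → Carrier} xs → (∀ x → f x ≈ g x) → sumK (map f xs) ≈ sumK (map g xs)
  sumK-cong []       _   = F.refl
  sumK-cong (x ∷ xs) f≈g = F.+-cong (f≈g x) (sumK-cong xs f≈g)

  sumK-zero : ∀ {a} {A : Set a} {f : A → Carrier} xs → (∀ {x} → x ∈ xs → f x ≈ 0#) → sumK (map f xs) ≈ 0#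
  sumK-zero []       _   = F.refl
  sumK-zero (x ∷ xs) f≈0 = F.trans (F.+-cong (f≈0 (here refl)) (sumK-zero xs (f≈0 ∘ there))) (F.+-identityˡ 0#)

  -- The `key` serves plain lists through `id` and lists of coefficient-index pairs through `proj₂`,
  -- where only the indices are known to be distinct.
  sumK-single : ∀ {a} {A : Set a} {B : Set} {f : A → Carrier} (key : A → B) {xs x} →
    AllPairs (_≢_ on key) xs → x ∈ xs → (∀ {y} → y ∈ xs → key y ≢ key x → f y ≈ 0#) → sumK (map f xs) ≈ f x
  sumK-single key {xs = _ ∷ xs} (x∉ ∷ _) (here refl) f≈0 = F.trans
    (F.+-congˡ (sumK-zero xs λ y∈ → f≈0 (there y∈) (All.lookup x∉ y∈ ∘ sym)))
    (F.+-identityʳ _)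
  sumK-single key (y∉ ∷ xs!) (there x∈) f≈0 = F.trans
    (F.+-cong (f≈0 (here refl) (All.lookup y∉ x∈)) (sumK-single key xs! x∈ (f≈0 ∘ there)))
    (F.+-identityˡ _)

  sumS-at : ∀ {a} {A : Set a} (G : A → Series) xs w → sumS (map G xs) w ≡ sumK (map (λ x → G x w) xs)
  sumS-at G []       w = refl
  sumS-at G (x ∷ xs) w = cong (G x w ⊕_) (sumS-at G xs w)

  M-one : ∀ u w → pack w ≡ u → M u w ≡ 1#
  M-one u w eq rewrite dec-true (≡-dec _≟_ (pack w) u) eq = refl

  M-zero : ∀ u w → pack w ≢ u → M u w ≡ 0#
  M-zero u w neq rewrite dec-false (≡-dec _≟_ (pack w) u) neq = refl

  M-invariant : ∀ u {v w} → v ≃ w → M u v ≡ M u w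
  M-invariant u v≃w = cong (λ p → if does (≡-dec _≟_ p u) then 1# else 0#) (≃⇒pack-≡ v≃w)

  -- Homogeneity of `f` in length kills every splitting of `w` but one.
  #-at : ∀ {k} f g w → (∀ v → length v ≢ suc k → f v ≈ 0#) → k < length w →
    (f # g) w ≈ f (take (suc k) w) ⊛ g (drop k w)
  #-at f g w f≈0 k<n = sumK-single id (Unique.upTo⁺ (length w)) (∈-upTo⁺ k<n) λ {j} j∈ j≢k →
    F.trans (F.*-congʳ (f≈0 (take (suc j) w) λ eq →
              j≢k (suc-injective (trans (sym (length-take-≤ (suc j) w (∈-upTo⁻ j∈))) eq))))
      (F.zeroˡ _)

  #-zero : ∀ {k} f g w → (∀ v → length v ≢ suc k → f v ≈ 0#) → ¬ k < length w → (f # g) w ≈ 0#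
  #-zero f g w f≈0 k≮n = sumK-zero (upTo (length w)) λ {j} j∈ →
    F.trans (F.*-congʳ (f≈0 (take (suc j) w) λ eq →
              k≮n (subst (_< length w) (suc-injective (trans (sym (length-take-≤ (suc j) w (∈-upTo⁻ j∈))) eq)) (∈-upTo⁻ j∈))))
      (F.zeroˡ _)

  -- Says that `gen u` is `M u` plus lower terms. Coefficients are read on all words, with
  -- `invariant` reducing them to order types; `support` is a disjunction because equality in `K` is
  -- not assumed decidable.
  record Unitriangular (gen : Word → Series) : Set (c Level.⊔ ℓ) where
    field
      inWQSym   : ∀ {u} → NonSecable u → InWQSym (gen u)
      invariant : ∀ u {v w} → v ≃ w → gen u v ≈ gen u w
      diagonal  : ∀ {u} → IsPacked u → gen u u ≈ 1#
      support   : ∀ {u} → IsPacked u → ∀ w → gen u w ≈ 0# ⊎ w ⊑ u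

  singleton-⊑ : ∀ {v w : Word} → length v ≡ 1 → length w ≡ 1 → v ⊑ w
  singleton-⊑ {_ ∷ []} {_ ∷ []} _ _ = record
    { len = refl ; ≤-pres = λ { {_} {zero} () ; {_} {suc _} _ (s≤s ()) } ; <-pres = λ { {_} {zero} () ; {_} {suc _} _ (s≤s ()) } }

  -- At `w` only the term of `pack w` survives.
  expansion : ∀ {f n} → (∀ {v w} → v ≃ w → f v ≈ f w) → (∀ w → length w ≢ n → f w ≈ 0#) →
    f ≈S sumS (map (λ v → f v ·S M v) (packedWords n))
  expansion {f} {n} inv f≈0 w = F.trans (byLength (length w ≟ n))
    (F.reflexive (sym (sumS-at (λ v → f v ·S M v) (packedWords n) w)))
    where
    byLength : Dec (length w ≡ n) → f w ≈ sumK (map (λ v → f v ⊛ M v w) (packedWords n))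
    byLength (yes refl) = begin
      f w                                                        ≈⟨ inv (≃-sym (pack-≃ w)) ⟩
      f (pack w)                                                 ≈⟨ F.*-identityʳ _ ⟨
      f (pack w) ⊛ 1#                                            ≡⟨ cong (f (pack w) ⊛_) (M-one (pack w) w refl) ⟨
      f (pack w) ⊛ M (pack w) w                                  ≈⟨ sumK-single id (packedWords-unique n)
        (subst (λ m → pack w ∈ packedWords m) (length-pack w) (packedWords-∈ (pack-packed w)))
        (λ {v} _ v≢pw → F.trans (F.*-congˡ (F.reflexive (M-zero v w (v≢pw ∘ sym)))) (F.zeroʳ _)) ⟨
      sumK (map (λ v → f v ⊛ M v w) (packedWords n))             ∎
    byLength (no len≢n) = F.trans (f≈0 w len≢n) (F.sym (sumK-zero (packedWords n) λ {v} v∈ →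
      F.trans (F.*-congˡ (F.reflexive (M-zero v w λ eq →
                len≢n (trans (trans (sym (length-pack w)) (cong length eq)) (proj₁ (packedWords⁻ v∈))))))
        (F.zeroʳ _)))

  module _ {gen : Word → Series} (unitriangular : Unitriangular gen) where
    open Unitriangular unitriangular

    gen-zero : ∀ {u k} → IsPacked u → length u ≡ suc k → ∀ v → length v ≢ suc k → gen u v ≈ 0#
    gen-zero u-packed eq v neq with support u-packed v
    ... | inj₁ v≈0 = v≈0
    ... | inj₂ v⊑u  = contradiction (trans (len v⊑u) eq) neq

    monomial-invariant : ∀ us {v w} → v ≃ w → monomial gen us v ≈ monomial gen us w
    monomial-invariant []       v≃w = F.reflexive (M-invariant (1 ∷ []) v≃w)
    -- Equal lengths give both products the same list of splittings.
    monomial-invariant (u ∷ us) {v} {w} v≃w rewrite len (proj₁ v≃w) = sumK-cong (upTo (length w)) λ k →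
      F.*-cong (invariant u (≃-take (suc k) v≃w)) (monomial-invariant us (≃-drop k v≃w))

    -- Only the splitting at `k` contributes. Either one of its two factors vanishes, or both parts
    -- of `v` lie below those of `w` and `⊑-glue` applies.
    monomial-support : ∀ {us w} → All NonSecable us → Glued us w → ∀ v → monomial gen us v ≈ 0# ⊎ v ⊑ w
    monomial-support [] (unit eq) v with ≡-dec _≟_ (pack v) (1 ∷ [])
    ... | yes pv≡1 = inj₂ (singleton-⊑ (trans (sym (length-pack v)) (cong length pv≡1)) eq)
    ... | no  _    = inj₁ F.refl
    monomial-support {u ∷ us} ((u-packed , _) ∷ nss) (_⟨_,_,_⟩∷_ {k = k} eq k<n pre cut suf) v with k <? length v
    ... | no  k≮v = inj₁ (#-zero (gen u) (monomial gen us) v (gen-zero u-packed eq) k≮v)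
    ... | yes k<v with support u-packed (take (suc k) v) | monomial-support nss suf (drop k v)
    ...   | inj₁ v≈0 | _         = inj₁ (F.trans (#-at (gen u) (monomial gen us) v (gen-zero u-packed eq) k<v) (F.trans (F.*-congʳ v≈0) (F.zeroˡ _)))
    ...   | inj₂ _    | inj₁ v≈0 = inj₁ (F.trans (#-at (gen u) (monomial gen us) v (gen-zero u-packed eq) k<v) (F.trans (F.*-congˡ v≈0) (F.zeroʳ _)))
    ...   | inj₂ pre⊑ | inj₂ suf⊑ = inj₂ (⊑-glue k<v k<n cut (⊑-trans pre⊑ (≃⇒⊑ (≃-sym pre))) suf⊑)

    monomial-diagonal : ∀ {us w} → All NonSecable us → Glued us w → monomial gen us w ≈ 1#
    monomial-diagonal [] (unit {w} eq) =
      F.reflexive (M-one (1 ∷ []) w (≃⇒pack-≡ {w} {1 ∷ []} (⊑-antisym (singleton-⊑ eq refl) (singleton-⊑ refl eq))))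
    monomial-diagonal {u ∷ us} {w} ((u-packed , _) ∷ nss) (_⟨_,_,_⟩∷_ {k = k} eq k<n pre cut suf) = begin
      (gen u # monomial gen us) w                         ≈⟨ #-at (gen u) (monomial gen us) w (gen-zero u-packed eq) k<n ⟩
      gen u (take (suc k) w) ⊛ monomial gen us (drop k w) ≈⟨ F.*-cong (F.trans (invariant u pre) (diagonal u-packed)) (monomial-diagonal nss suf) ⟩
      1# ⊛ 1#                                             ≈⟨ F.*-identityˡ 1# ⟩
      1#                                                  ∎

    monomial-zero : ∀ {us w} → All NonSecable us → Glued us w → ∀ v → length v ≢ length w → monomial gen us v ≈ 0#
    monomial-zero nss gl v neq with monomial-support nss gl v
    ... | inj₁ v≈0 = v≈0
    ... | inj₂ v⊑w  = contradiction (len v⊑w) neq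

    -- The relation is evaluated at `top us`. Another monomial that may be nonzero there has a
    -- strictly greater `top`, so its coefficient is already zero by descending induction on
    -- `inversions`.
    independent : ∀ (xs : List (Carrier × List Word)) → All (λ p → All NonSecable (proj₂ p)) xs →
      Unique (map proj₂ xs) → lincomb (monomial gen) xs ≈S zeroS → All (λ p → proj₁ p ≈ 0#) xs
    independent xs nss xs! lin≈0 = All.tabulate λ p∈ → coefficient≈0 p∈ (<-wellFounded _)
      where
      height : Carrier × List Word → ℕ
      height p = inversions (top (proj₂ p))
      -- Bounds all heights, so the distance to it decreases as the height grows.
      maxHeight = maxW (map height xs)

      coefficient≈0 : ∀ {p} → p ∈ xs → Acc _<_ (maxHeight ∸ height p) → proj₁ p ≈ 0#
      coefficient≈0 {a , us} p∈ (acc higher) = begin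
        a                                                       ≈⟨ F.*-identityʳ a ⟨
        a ⊛ 1#                                                  ≈⟨ F.*-congˡ (monomial-diagonal ns gl) ⟨
        a ⊛ monomial gen us t                                   ≈⟨ sumK-single proj₂ (AllPairs.map⁻ xs!) p∈ others ⟨
        sumK (map (λ q → proj₁ q ⊛ monomial gen (proj₂ q) t) xs) ≡⟨ sumS-at (λ q → proj₁ q ·S monomial gen (proj₂ q)) xs t ⟨
        lincomb (monomial gen) xs t                             ≈⟨ lin≈0 t ⟩
        0#                                                      ∎
        where
        t  = top us
        ns = All.lookup nss p∈
        gl = top-glued ns
        others : ∀ {q} → q ∈ xs → proj₂ q ≢ us → proj₁ q ⊛ monomial gen (proj₂ q) t ≈ 0#
        others {q} q∈ q≢us with nsq ← All.lookup nss q∈ with monomial-support nsq (top-glued nsq) t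
        ... | inj₁ v≈0 = F.trans (F.*-congˡ v≈0) (F.zeroʳ _)
        ... | inj₂ t⊑   = F.trans (F.*-congʳ (coefficient≈0 q∈ (higher (∸-monoʳ-<
                (⊑⇒inversions-< t⊑ λ t≃ → q≢us (glued-unique nsq ns (top-glued nsq) (glued-≃ t≃ gl)))
                (∈⇒≤maxW (∈-map⁺ height q∈)))))) (F.zeroˡ _)

    -- Spanning

    Spanned : Series → Set (c Level.⊔ ℓ)
    Spanned f = ∃ λ (xs : List (Carrier × List Word)) →
      All (λ p → All NonSecable (proj₂ p)) xs × (f ≈S lincomb (monomial gen) xs)

    spanned-≈ : ∀ {f g} → f ≈S g → Spanned g → Spanned f
    spanned-≈ f≈g (xs , nss , eq) = xs , nss , λ w → F.trans (f≈g w) (eq w)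

    spanned-zero : ∀ {f} → f ≈S zeroS → Spanned f
    spanned-zero f≈0 = [] , [] , f≈0

    spanned-monomial : ∀ {us} → All NonSecable us → Spanned (monomial gen us)
    spanned-monomial {us} nss = (1# , us) ∷ [] , nss ∷ [] ,
      λ w → F.sym (F.trans (F.+-identityʳ _) (F.*-identityˡ _))

    spanned-+ : ∀ {f g} → Spanned f → Spanned g → Spanned (f +S g)
    spanned-+ (xs , nss , f≈) (ys , nss′ , g≈) = xs ++ ys , All.++⁺ nss nss′ ,
      λ w → F.trans (F.+-cong (f≈ w) (g≈ w)) (F.sym (lincomb-++ xs w))
      where
      lincomb-++ : ∀ xs w → lincomb (monomial gen) (xs ++ ys) w ≈ lincomb (monomial gen) xs w ⊕ lincomb (monomial gen) ys w
      lincomb-++ []       w = F.sym (F.+-identityˡ _)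
      lincomb-++ (x ∷ xs) w = F.trans (F.+-congˡ (lincomb-++ xs w)) (F.sym (F.+-assoc _ _ _))

    spanned-· : ∀ a {f} → Spanned f → Spanned (a ·S f)
    spanned-· a (xs , nss , f≈) = map (λ p → a ⊛ proj₁ p , proj₂ p) xs , All.map⁺ nss ,
      λ w → F.trans (F.*-congˡ (f≈ w)) (lincomb-· xs w)
      where
      lincomb-· : ∀ xs w → a ⊛ lincomb (monomial gen) xs w ≈ lincomb (monomial gen) (map (λ p → a ⊛ proj₁ p , proj₂ p) xs) w
      lincomb-· []       w = F.zeroʳ a
      lincomb-· (x ∷ xs) w = F.trans (F.distribˡ a _ _) (F.+-cong (F.sym (F.*-assoc a _ _)) (lincomb-· xs w))

    spanned-sum : ∀ {a} {A : Set a} (G : A → Series) xs → (∀ {x} → x ∈ xs → Spanned (G x)) → Spanned (sumS (map G xs))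
    spanned-sum G []       _ = spanned-zero λ _ → F.refl
    spanned-sum G (x ∷ xs) s = spanned-+ (s (here refl)) (spanned-sum G xs (s ∘ there))

    neg-cancel : ∀ x → (⊖ 1#) ⊛ x ⊕ x ≈ 0#
    neg-cancel x = begin
      (⊖ 1#) ⊛ x ⊕ x      ≈⟨ F.+-congˡ (F.*-identityˡ x) ⟨
      (⊖ 1#) ⊛ x ⊕ 1# ⊛ x ≈⟨ F.distribʳ x (⊖ 1#) 1# ⟨
      (⊖ 1# ⊕ 1#) ⊛ x     ≈⟨ F.*-congʳ (F.-‿inverseˡ 1#) ⟩
      0# ⊛ x              ≈⟨ F.zeroˡ x ⟩
      0#                  ∎

    -- Subtracting from `M u` the monomial of its factorization leaves a remainder supported
    -- strictly below `u`: the coefficients at `u` cancel, and the others fall to induction on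
    -- `inversions`.
    spanned-M : ∀ {u} → IsPacked u → 1 ≤ length u → Acc _<_ (inversions u) → Spanned (M u)
    spanned-M {u} u-packed 1≤n (acc smaller) with us , nss , gl ← factorize u 1≤n =
      spanned-≈ (λ w → F.sym (F.trans (F.+-assoc _ _ _) (F.trans (F.+-congˡ (neg-cancel _)) (F.+-identityʳ _))))
        (spanned-+ (spanned-≈ (expansion remainder-invariant remainder-zero) (spanned-sum _ _ spanned-term)) (spanned-monomial nss))
      where
      remainder : Series
      remainder = M u +S ((⊖ 1#) ·S monomial gen us)

      remainder-≈0 : ∀ {w} → M u w ≈ 0# → monomial gen us w ≈ 0# → remainder w ≈ 0#
      remainder-≈0 M≈0 mono≈0 = F.trans (F.+-cong M≈0 (F.trans (F.*-congˡ mono≈0) (F.zeroʳ _))) (F.+-identityˡ 0#)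

      remainder-invariant : ∀ {v w} → v ≃ w → remainder v ≈ remainder w
      remainder-invariant v≃w = F.+-cong (F.reflexive (M-invariant u v≃w)) (F.*-congˡ (monomial-invariant us v≃w))

      remainder-zero : ∀ w → length w ≢ length u → remainder w ≈ 0#
      remainder-zero w neq = remainder-≈0
        (F.reflexive (M-zero u w λ eq → neq (trans (sym (length-pack w)) (cong length eq)))) (monomial-zero nss gl w neq)

      spanned-term : ∀ {v} → v ∈ packedWords (length u) → Spanned (remainder v ·S M v)
      spanned-term {v} v∈ with v-len , v-packed ← packedWords⁻ v∈ with ≡-dec _≟_ v u
      ... | yes refl = spanned-zero λ w → F.trans (F.*-congʳ remainder-u≈0) (F.zeroˡ _)
        where
        remainder-u≈0 : remainder v ≈ 0#
        remainder-u≈0 = begin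
          M v v ⊕ (⊖ 1#) ⊛ monomial gen us v ≈⟨ F.+-cong (F.reflexive (M-one v v v-packed)) (F.*-congˡ (monomial-diagonal nss gl)) ⟩
          1# ⊕ (⊖ 1#) ⊛ 1#                   ≈⟨ F.+-comm _ _ ⟩
          (⊖ 1#) ⊛ 1# ⊕ 1#                   ≈⟨ neg-cancel 1# ⟩
          0#                                 ∎
      ... | no v≢u with monomial-support nss gl v
      ...   | inj₁ v≈0 = spanned-zero λ w → F.trans
              (F.*-congʳ (remainder-≈0 (F.reflexive (M-zero u v (v≢u ∘ trans (sym v-packed)))) v≈0)) (F.zeroˡ _)
      ...   | inj₂ v⊑u  = spanned-· (remainder v) (spanned-M v-packed (subst (1 ≤_) (sym v-len) 1≤n)
              (smaller (⊑⇒inversions-< v⊑u (v≢u ∘ packed-≃⇒≡ v-packed u-packed))))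

    freelyGenerates : FreelyGenerates gen NonSecable
    freelyGenerates = (λ _ → inWQSym) , independent , λ { f (xs , packed , f≈) →
      spanned-≈ f≈ (spanned-sum _ xs λ {p} p∈ →
        let u-packed , 1≤n = All.lookup packed p∈ in spanned-· (proj₁ p) (spanned-M u-packed 1≤n (<-wellFounded _))) }

  -- The two families

  M-unitriangular : Unitriangular M
  M-unitriangular = record
    { inWQSym   = λ { {u} (u-packed , 2≤n , _) → (1# , u) ∷ [] , (u-packed , <⇒≤ 2≤n) ∷ [] ,
                      λ w → F.sym (F.trans (F.+-identityʳ _) (F.*-identityˡ _)) }
    ; invariant = λ u v≃w → F.reflexive (M-invariant u v≃w)
    ; diagonal  = λ {u} u-packed → F.reflexive (M-one u u u-packed)
    ; support   = support
    }
    where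
    support : ∀ {u} → IsPacked u → ∀ w → M u w ≈ 0# ⊎ w ⊑ u
    support {u} _ w with ≡-dec _≟_ (pack w) u
    ... | yes refl = inj₂ (≃⇒⊑ (≃-sym (pack-≃ w)))
    ... | no  _    = inj₁ F.refl

  -- The only summand `M v` of `S u` that can be nonzero at `w` is that of `v = pack w`. It is
  -- present only if `pack w` is below `u`, and for `w = u` it occurs exactly once.
  S-unitriangular : Unitriangular S
  S-unitriangular = record
    { inWQSym   = λ { {u} (u-packed , 2≤n , _) → map (1# ,_) (below u) ,
                      All.map⁺ (All.tabulate λ v∈ →
                        let v-len , v-packed = packedWords⁻ (proj₁ (∈-filter⁻ (≤u? u) v∈))
                        in v-packed , subst (1 ≤_) (sym v-len) (<⇒≤ 2≤n)) ,
                      λ w → unscaled (below u) w }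
    ; invariant = λ u {v} {w} v≃w → F.trans (F.reflexive (sumS-at M (below u) v))
                    (F.trans (sumK-cong (below u) λ x → F.reflexive (M-invariant x v≃w)) (F.reflexive (sym (sumS-at M (below u) w))))
    ; diagonal  = λ {u} u-packed → F.trans (F.reflexive (sumS-at M (below u) u))
                    (F.trans (sumK-single id (Unique.filter⁺ (≤u? u) (packedWords-unique (length u)))
                               (∈-filter⁺ (≤u? u) (packedWords-∈ u-packed) (≤PPᵇ-refl u))
                               λ {v} _ v≢u → F.reflexive (M-zero v u λ eq → v≢u (trans (sym eq) u-packed)))
                      (F.reflexive (M-one u u u-packed)))
    ; support   = support
    }
    where
    ≤u? : ∀ u v → Dec (T (v ≤PPᵇ u))
    ≤u? u v = T? (v ≤PPᵇ u)

    below : Word → List Word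
    below u = filter (≤u? u) (packedWords (length u))

    unscaled : ∀ vs w → sumS (map M vs) w ≈ lincomb M (map (1# ,_) vs) w
    unscaled []       w = F.refl
    unscaled (v ∷ vs) w = F.+-cong (F.sym (F.*-identityˡ _)) (unscaled vs w)

    support : ∀ {u} → IsPacked u → ∀ w → S u w ≈ 0# ⊎ w ⊑ u
    support {u} _ w with Any.any? (≡-dec _≟_ (pack w)) (below u)
    ... | yes pw∈ = inj₂ (⊑-trans (≃⇒⊑ (≃-sym (pack-≃ w))) (≤PPᵇ⇒⊑ (proj₂ (∈-filter⁻ (≤u? u) {xs = packedWords (length u)} pw∈))))
    ... | no  pw∉ = inj₁ (F.trans (F.reflexive (sumS-at M (below u) w))
                      (sumK-zero (below u) λ {v} v∈ → F.reflexive (M-zero v w λ { refl → pw∉ v∈ })))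

theorem5p5 : ∀ {c ℓ : Level} (K : Field c ℓ) →
    let open WQSymDefs K in
    FreelyGenerates S NonSecable × FreelyGenerates M NonSecable
theorem5p5 K = freelyGenerates S-unitriangular , freelyGenerates M-unitriangular
  where open FreeGeneration K
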